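{- Let $G$ be a decompleted symmetric X-ladder with $|V(G)|\ge 7$. That is, for an integer $m\ge 4$, let $\Gamma$ be the 4-regular graph with vertices $u_i,v_i$ ($i\in\mathbb{Z}/m\mathbb{Z}$) whose edges are $u_iu_{i+1},\,u_iv_{i+1},\,v_iu_{i+1},\,v_iv_{i+1}$ for all $i\in\mathbb{Z}/m\mathbb{Z}$, and let $G=\Gamma\setminus u_1$. Then $c_2^{(2)}(G)=0$.
   Context: $\Gamma\setminus u_1$ denotes the graph obtained by deleting the vertex $u_1$ and its incident edges; all vertices of $\Gamma$ are equivalent under automorphisms. For a connected graph $G$, assign a variable $\alpha_e$ to each edge $e$. The Kirchhoff polynomial is $\Psi_G=\sum_T\prod_{e\notin T}\alpha_e$, the sum running over all spanning trees $T$ of $G$. For a prime $p$, $[\Psi_G]_p$ is the number of zeros of $\Psi_G$ in $\mathbb{F}_p^{|E(G)|}$. If $G$ has at least 3 vertices, then $[\Psi_G]_p$ is divisible by $p^2$, and the $c_2$ invariant of $G$ at $p$ is $c_2^{(p)}(G)=\frac{[\Psi_G]_p}{p^2}\bmod p$. -}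

module Defs where

open import Algebra.Bundles.Raw using (RawSemiring)
open import Data.Fin using (Fin; toℕ; fromℕ<)
open import Data.Fin.Properties using (all?; injective⇒≤; toℕ-fromℕ<) renaming (_≟_ to _≟ᶠ_; any? to anyᶠ?)
open import Data.Fin.Subset using (Subset; inside; outside; _∈_)
open import Data.Fin.Subset.Properties using (_∈?_)
open import Data.List using (List; []; _∷_; _++_; map; filter; foldr; length; allFin; concatMap; cartesianProductWith)
import Data.List as List
open import Data.List.Membership.Propositional using () renaming (_∈_ to _∈ˡ_)
open import Data.List.Membership.Propositional.Properties
  using (∈-filter⁺; ∈-filter⁻; ∈-++⁺ˡ; ∈-++⁺ʳ; ∈-map⁺; ∈-allFin; ∈-lookup; ∈-cartesianProductWith⁺; ∈-map⁻)
open import Data.List.Relation.Unary.All as All using (All)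
import Data.List.Relation.Unary.Any as Any
open import Data.List.Relation.Unary.Any using (here; there)
open import Data.Nat using (ℕ; zero; suc; _+_; _*_; NonZero)
open import Data.Nat.DivMod using (_/_; _%_; _mod_)
open import Data.Nat.Properties using (m*n≢0)
open import Data.Product using (Σ; ∃; ∃-syntax; _×_; _,_; proj₁; proj₂)
open import Data.Product.Properties using (≡-dec)
open import Data.Sum using (_⊎_; inj₁; inj₂)
open import Data.Vec as Vec using (Vec; lookup)
open import Data.Vec.Relation.Unary.Unique.Propositional using (Unique)
open import Data.Vec.Relation.Unary.Unique.Propositional.Properties using (lookup-injective)
open import Data.Vec.Relation.Unary.AllPairs using (allPairs?)
open import Function using (_∘_)
open import Level using (0ℓ)
open import Relation.Binary using (DecidableEquality)
open import Relation.Binary.Construct.Closure.ReflexiveTransitive using (Star; ε; _◅_; _◅◅_)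
open import Relation.Binary.PropositionalEquality using (_≡_; _≢_; refl; sym; trans; cong; subst)
open import Relation.Nullary using (¬_; Dec; no; ¬?; _×-dec_; _⊎-dec_; map′)

-- Finite undirected graphs; an edge is an entry of the list `edges`, and its
-- two ends are recorded in an arbitrary order.
record Graph : Set₁ where
  field
    V        : Set
    _≟_      : DecidableEquality V
    vertices : List V
    edges    : List (V × V)
    ends∈    : All (λ e → proj₁ e ∈ˡ vertices × proj₂ e ∈ˡ vertices) edges

  Edge : Set
  Edge = Fin (length edges)

  ends : Edge → V × V
  ends = List.lookup edges

open Graph using (V; vertices; edges; Edge; ends)

deleteVertex : (G : Graph) → V G → Graph
deleteVertex G w = record
  { V        = V G
  ; _≟_      = _≟_
  ; vertices = filter keepV? (vertices G)
  ; edges    = filter keepE? (edges G)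
  ; ends∈    = All.tabulate valid
  }
  where
  open Graph G using (_≟_; ends∈)

  keepV? : (x : V G) → Dec (x ≢ w)
  keepV? x = ¬? (x ≟ w)

  keepE? : (e : V G × V G) → Dec (proj₁ e ≢ w × proj₂ e ≢ w)
  keepE? (x , y) = keepV? x ×-dec keepV? y

  valid : ∀ {e} → e ∈ˡ filter keepE? (edges G) →
          proj₁ e ∈ˡ filter keepV? (vertices G) × proj₂ e ∈ˡ filter keepV? (vertices G)
  valid e∈ with ∈-filter⁻ keepE? e∈
  ... | e∈G , x≢w , y≢w with All.lookup ends∈ e∈G
  ... | x∈ , y∈ = ∈-filter⁺ keepV? x∈ x≢w , ∈-filter⁺ keepV? y∈ y≢w

-- i ↦ i + 1 in ℤ/m, with Fin m as the set of residues.
next : ∀ {m} .{{_ : NonZero m}} → Fin m → Fin m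
next {m} i = suc (toℕ i) mod m

module _ (G : Graph) where
  open Graph G using (_≟_)

  Joins : Edge G → V G → V G → Set
  Joins e x y = ends G e ≡ (x , y) ⊎ ends G e ≡ (y , x)

  Adj : Subset (length (edges G)) → V G → V G → Set
  Adj T x y = ∃[ e ] (e ∈ T × Joins e x y)

  -- Connectedness of the spanning subgraph (V(G), T).
  Connected : Subset (length (edges G)) → Set
  Connected T = All (λ x → All (λ y → Star (Adj T) x y) (vertices G)) (vertices G)

  -- A cycle of length n + 1: distinct vertices x₀, …, xₙ and distinct edges
  -- e₀, …, eₙ of T with eᵢ joining xᵢ to xᵢ₊₁, indices taken modulo n + 1.
  IsCycle : Subset (length (edges G)) → ∀ {n} → Vec (V G) (suc n) → Vec (Edge G) (suc n) → Set
  IsCycle T xs es =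
    Unique xs × Unique es ×
    (∀ i → lookup es i ∈ T × Joins (lookup es i) (lookup xs i) (lookup xs (next i)))

  Acyclic : Subset (length (edges G)) → Set
  Acyclic T = ¬ (∃[ n ] Σ (Vec (V G) (suc n)) λ xs → Σ (Vec (Edge G) (suc n)) λ es → IsCycle T xs es)

  IsSpanningTree : Subset (length (edges G)) → Set
  IsSpanningTree T = Connected T × Acyclic T

-- All vectors of length n with entries from a list.
vecs : ∀ {a} {A : Set a} → List A → (n : ℕ) → List (Vec A n)
vecs xs zero    = Vec.[] ∷ []
vecs xs (suc n) = cartesianProductWith Vec._∷_ xs (vecs xs n)

∈-vecs : ∀ {a} {A : Set a} {xs : List A} {n} (v : Vec A n) → (∀ i → lookup v i ∈ˡ xs) → v ∈ˡ vecs xs n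
∈-vecs Vec.[]      _ = here refl
∈-vecs (x Vec.∷ v) h = ∈-cartesianProductWith⁺ Vec._∷_ (h Fin.zero) (∈-vecs v (h ∘ Fin.suc))

subsets : (n : ℕ) → List (Subset n)
subsets = vecs (outside ∷ inside ∷ [])

anyIn? : ∀ {A : Set} {P : A → Set} (xs : List A) → (∀ x → P x → x ∈ˡ xs) → (∀ x → Dec (P x)) → Dec (∃ P)
anyIn? xs complete P? = map′ Any.satisfied (λ (x , px) → Any.map (λ { refl → px }) (complete x px)) (Any.any? P? xs)

-- Decidability of reachability: `Reach es` is reachability along the edges
-- listed in es, by recursion on that list.
module _ {A : Set} (_≟_ : DecidableEquality A) where

  Reach : List (A × A) → A → A → Set
  Reach []             x y = x ≡ y
  Reach ((a , b) ∷ es) x y = Reach es x y ⊎ (Reach es x a × Reach es b y) ⊎ (Reach es x b × Reach es a y)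

  reach? : ∀ es x y → Dec (Reach es x y)
  reach? []             x y = x ≟ y
  reach? ((a , b) ∷ es) x y =
    reach? es x y ⊎-dec (reach? es x a ×-dec reach? es b y) ⊎-dec (reach? es x b ×-dec reach? es a y)

  reach-refl : ∀ es {x} → Reach es x x
  reach-refl []       = refl
  reach-refl (_ ∷ es) = inj₁ (reach-refl es)

  reach-trans : ∀ es {x y z} → Reach es x y → Reach es y z → Reach es x z
  reach-trans []       p q = trans p q
  reach-trans (_ ∷ es) (inj₁ p)              (inj₁ q)              = inj₁ (reach-trans es p q)
  reach-trans (_ ∷ es) (inj₁ p)              (inj₂ (inj₁ (q , r))) = inj₂ (inj₁ (reach-trans es p q , r))
  reach-trans (_ ∷ es) (inj₁ p)              (inj₂ (inj₂ (q , r))) = inj₂ (inj₂ (reach-trans es p q , r))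
  reach-trans (_ ∷ es) (inj₂ (inj₁ (p , s))) (inj₁ q)              = inj₂ (inj₁ (p , reach-trans es s q))
  reach-trans (_ ∷ es) (inj₂ (inj₁ (p , s))) (inj₂ (inj₁ (q , r))) = inj₂ (inj₁ (p , r))
  reach-trans (_ ∷ es) (inj₂ (inj₁ (p , s))) (inj₂ (inj₂ (q , r))) = inj₁ (reach-trans es p r)
  reach-trans (_ ∷ es) (inj₂ (inj₂ (p , s))) (inj₁ q)              = inj₂ (inj₂ (p , reach-trans es s q))
  reach-trans (_ ∷ es) (inj₂ (inj₂ (p , s))) (inj₂ (inj₁ (q , r))) = inj₁ (reach-trans es p r)
  reach-trans (_ ∷ es) (inj₂ (inj₂ (p , s))) (inj₂ (inj₂ (q , r))) = inj₂ (inj₂ (p , r))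

  reach-step : ∀ es {x y} → (x , y) ∈ˡ es ⊎ (y , x) ∈ˡ es → Reach es x y
  reach-step (_ ∷ es) (inj₁ (here refl)) = inj₂ (inj₁ (reach-refl es , reach-refl es))
  reach-step (_ ∷ es) (inj₂ (here refl)) = inj₂ (inj₂ (reach-refl es , reach-refl es))
  reach-step (_ ∷ es) (inj₁ (there p))   = inj₁ (reach-step es (inj₁ p))
  reach-step (_ ∷ es) (inj₂ (there p))   = inj₁ (reach-step es (inj₂ p))

  reach-sound : ∀ {R : A → A → Set} es → (∀ {x y} → (x , y) ∈ˡ es → R x y × R y x) →
                ∀ {x y} → Reach es x y → Star R x y
  reach-sound []       h refl = ε
  reach-sound (_ ∷ es) h (inj₁ p)              = reach-sound es (h ∘ there) p
  reach-sound (_ ∷ es) h (inj₂ (inj₁ (p , q))) =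
    reach-sound es (h ∘ there) p ◅◅ (proj₁ (h (here refl)) ◅ reach-sound es (h ∘ there) q)
  reach-sound (_ ∷ es) h (inj₂ (inj₂ (p , q))) =
    reach-sound es (h ∘ there) p ◅◅ (proj₂ (h (here refl)) ◅ reach-sound es (h ∘ there) q)

module _ (G : Graph) (T : Subset (length (edges G))) where
  open Graph G using (_≟_; ends∈)

  private
    treeEdges : List (Edge G)
    treeEdges = filter (_∈? T) (allFin _)

    star? : ∀ x y → Dec (Star (Adj G T) x y)
    star? x y = map′ (reach-sound _≟_ es sound) complete (reach? _≟_ es x y)
      where
      es : List (V G × V G)
      es = map (ends G) treeEdges

      sound : ∀ {a b} → (a , b) ∈ˡ es → Adj G T a b × Adj G T b a
      sound p with ∈-map⁻ (ends G) p
      ... | e , e∈ , eq with ∈-filter⁻ (_∈? T) {xs = allFin _} e∈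
      ... | _ , e∈T = (e , e∈T , inj₁ (sym eq)) , (e , e∈T , inj₂ (sym eq))

      listed : ∀ {e a b} → e ∈ T → ends G e ≡ (a , b) → (a , b) ∈ˡ es
      listed e∈T refl = ∈-map⁺ (ends G) (∈-filter⁺ (_∈? T) (∈-allFin _) e∈T)

      complete : ∀ {a b} → Star (Adj G T) a b → Reach _≟_ es a b
      complete ε                            = reach-refl _≟_ es
      complete ((e , e∈T , inj₁ eq) ◅ rest) =
        reach-trans _≟_ es (reach-step _≟_ es (inj₁ (listed e∈T eq))) (complete rest)
      complete ((e , e∈T , inj₂ eq) ◅ rest) =
        reach-trans _≟_ es (reach-step _≟_ es (inj₂ (listed e∈T eq))) (complete rest)

    joins? : ∀ e x y → Dec (Joins G e x y)
    joins? e x y = ≡-dec _≟_ _≟_ (ends G e) (x , y) ⊎-dec ≡-dec _≟_ _≟_ (ends G e) (y , x)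

    joins⇒∈ : ∀ {e x y} → Joins G e x y → x ∈ˡ vertices G
    joins⇒∈ {e} (inj₁ eq) = subst (λ z → proj₁ z ∈ˡ vertices G) eq (proj₁ (All.lookup ends∈ (∈-lookup e)))
    joins⇒∈ {e} (inj₂ eq) = subst (λ z → proj₂ z ∈ˡ vertices G) eq (proj₂ (All.lookup ends∈ (∈-lookup e)))

    cycle? : ∀ {n} (xs : Vec (V G) (suc n)) (es : Vec (Edge G) (suc n)) → Dec (IsCycle G T xs es)
    cycle? xs es =
      allPairs? (λ x y → ¬? (x ≟ y)) xs ×-dec
      allPairs? (λ e f → ¬? (e ≟ᶠ f)) es ×-dec
      all? (λ i → (lookup es i ∈? T) ×-dec joins? (lookup es i) (lookup xs i) (lookup xs (next i)))

    Cyc : ℕ → Set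
    Cyc n = Σ (Vec (V G) (suc n)) λ xs → Σ (Vec (Edge G) (suc n)) λ es → IsCycle G T xs es

    cyc? : ∀ n → Dec (Cyc n)
    cyc? n = anyIn? (vecs (vertices G) (suc n))
      (λ { xs (_ , _ , _ , h) → ∈-vecs xs (λ i → joins⇒∈ (proj₂ (h i))) })
      (λ xs → anyIn? (vecs (allFin _) (suc n)) (λ es _ → ∈-vecs es (λ _ → ∈-allFin _)) (cycle? xs))

    cyclic? : Dec (∃ Cyc)
    cyclic? = map′ (λ (i , c) → toℕ i , c)
      (λ { (n , c@(_ , es , _ , u , _)) →
           let b = injective⇒≤ {f = lookup es} (lookup-injective u _ _)
           in fromℕ< b , subst Cyc (sym (toℕ-fromℕ< b)) c })
      (anyᶠ? (λ i → cyc? (toℕ i)))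

  isSpanningTree? : Dec (IsSpanningTree G T)
  isSpanningTree? = All.all? (λ x → All.all? (star? x) (vertices G)) (vertices G) ×-dec ¬? cyclic?

spanningTrees : (G : Graph) → List (Subset (length (edges G)))
spanningTrees G = filter (isSpanningTree? G) (subsets _)

-- The Kirchhoff polynomial, as the polynomial function it induces on any semiring.
Ψ : ∀ (G : Graph) {c ℓ} (R : RawSemiring c ℓ) →
    Vec (RawSemiring.Carrier R) (length (edges G)) → RawSemiring.Carrier R
Ψ G R α = sum (map (λ T → product (map (lookup α) (filter (λ e → ¬? (e ∈? T)) (allFin _)))) (spanningTrees G))
  where
  open RawSemiring R using (0#; 1#) renaming (_+_ to _⊕_; _*_ to _⊗_)
  sum product : List (RawSemiring.Carrier R) → RawSemiring.Carrier R
  sum     = foldr _⊕_ 0#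
  product = foldr _⊗_ 1#

-- ℤ/p on the residues 0, …, p - 1.
𝔽 : (p : ℕ) .{{_ : NonZero p}} → RawSemiring 0ℓ 0ℓ
𝔽 p = record
  { Carrier = Fin p
  ; _≈_     = _≡_
  ; _+_     = λ a b → (toℕ a + toℕ b) mod p
  ; _*_     = λ a b → (toℕ a * toℕ b) mod p
  ; 0#      = 0 mod p
  ; 1#      = 1 mod p
  }

-- [Ψ_G]_p
zeros : (G : Graph) (p : ℕ) .{{_ : NonZero p}} → ℕ
zeros G p = length (filter (λ α → Ψ G (𝔽 p) α ≟ᶠ (0 mod p)) (vecs (allFin p) (length (edges G))))

-- For p prime and G connected with at least three vertices the division by p²
-- is exact; otherwise the value has no meaning.
c₂ : (p : ℕ) .{{_ : NonZero p}} → Graph → ℕ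
c₂ p G = (zeros G p / (p * p)) % p
  where instance _ = m*n≢0 p p

data XVertex (m : ℕ) : Set where
  u v : Fin m → XVertex m

_≟ˣ_ : ∀ {m} → DecidableEquality (XVertex m)
u i ≟ˣ u j = map′ (cong u) (λ { refl → refl }) (i ≟ᶠ j)
u i ≟ˣ v j = no λ ()
v i ≟ˣ u j = no λ ()
v i ≟ˣ v j = map′ (cong v) (λ { refl → refl }) (i ≟ᶠ j)

symmetricXLadder : (m : ℕ) .{{_ : NonZero m}} → Graph
symmetricXLadder m = record
  { V        = XVertex m
  ; _≟_      = _≟ˣ_
  ; vertices = verts
  ; edges    = concatMap (λ i → (u i , u (next i)) ∷ (u i , v (next i)) ∷
                                (v i , u (next i)) ∷ (v i , v (next i)) ∷ []) (allFin m)
  ; ends∈    = All.tabulate (λ {e} _ → listed (proj₁ e) , listed (proj₂ e))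
  }
  where
  verts : List (XVertex m)
  verts = map u (allFin m) ++ map v (allFin m)

  listed : ∀ x → x ∈ˡ verts
  listed (u i) = ∈-++⁺ˡ (∈-map⁺ u (∈-allFin i))
  listed (v i) = ∈-++⁺ʳ (map u (allFin m)) (∈-map⁺ v (∈-allFin i))

decompletedXLadder : (m : ℕ) .{{_ : NonZero m}} → Graph
decompletedXLadder m = deleteVertex (symmetricXLadder m) (u (1 mod m))

{-# OPTIONS --safe #-}

-- Over 𝔽₂ the value Ψ(α) is the parity of the number of spanning trees that contain every edge
-- with αₑ = 0. Sweep the ladder layer by layer towards u₂, v₂: a set of edges already passed
-- matters only through the partition it induces on v₁ and the two vertices of the current layer.
-- Dually, the trees are completed according to a form h on 𝔽₂⁵, with coordinates indexed by these
-- partitions in the order of the data type, and passing one layer replaces h by one of 16 forms.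
-- Let Zₖ(h) be the number of zeros contributed by k layers completed according to h. Modulo 8,
-- Z₁ = 2s + 4 h₄ (h₀ ⊕ s) with s = h₁ ⊕ h₂ ⊕ h₃ ∈ {0, 1}, Z₂ = 4s, and Z₃ = 0, hence Zₖ = 0 for
-- all k ≥ 3. A ladder on m layers has k = m − 2, and for k = 2 all the final forms have s = 0.
-- So [Ψ_G]₂ is divisible by 8.
module Submission where

open import Defs
open import Algebra.Bundles using (CommutativeRing)
open import Algebra.Bundles.Raw using (RawSemiring)
import Algebra.Properties.CommutativeSemigroup as CommutativeSemigroupProperties
open import Data.Bool using (Bool; true; false; if_then_else_; _∧_; _∨_; not; _xor_; T)
open import Data.Bool.Properties using (xor-∧-commutativeRing; ∧-distribˡ-xor; ∧-zeroʳ; ∧-conicalˡ; ∧-conicalʳ)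
open import Data.Empty using (⊥; ⊥-elim)
open import Data.Fin using (Fin; zero; suc; toℕ; fromℕ; inject₁)
open import Data.Fin.Patterns using (0F; 1F; 2F; 3F; 4F)
open import Data.Fin.Properties using
  (all?; any?; toℕ-fromℕ<; toℕ-injective; toℕ<n; toℕ-inject₁; toℕ-fromℕ; 0≢1+n; suc-injective)
  renaming (_≟_ to _≟ᶠ_)
open import Data.Fin.Relation.Unary.Top using (view; ‵fromℕ; ‵inj₁)
open import Data.Fin.Subset using (Subset; inside; outside; _∈_; _∉_)
open import Data.Fin.Subset.Properties using (_∈?_; drop-there)
open import Data.List as List using (List; []; _∷_; _++_; map; filter; foldr; concatMap; length; allFin)
open import Data.List.Membership.Propositional using () renaming (_∈_ to _∈ˡ_)
open import Data.List.Membership.Propositional.Properties using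
  (∈-map⁺; ∈-map⁻; ∈-filter⁺; ∈-filter⁻; ∈-++⁺ˡ; ∈-++⁺ʳ; ∈-allFin)
open import Data.List.Properties using
  (map-∘; map-cong; map-++; map-tabulate; length-map; length-++; ++-assoc; ++-identityʳ; filter-++; filter-≐; filter-all)
open import Data.List.Relation.Binary.Permutation.Propositional as Perm using (_↭_; ↭-sym)
open import Data.List.Relation.Binary.Permutation.Propositional.Properties using (∈-resp-↭; ++-comm)
open import Data.List.Relation.Unary.All as All using (All; []; _∷_)
import Data.List.Relation.Unary.AllPairs as AllPairsˡ
open import Data.List.Relation.Unary.Any using (here; there)
import Data.List.Relation.Unary.Unique.Propositional as Uniqueˡ
import Data.List.Relation.Unary.Unique.Propositional.Properties as Uniqueˡ
open import Data.Maybe using (Maybe; just; nothing; _>>=_; maybe′)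
open import Data.Nat using (ℕ; zero; suc; _+_; _*_; _≤_; z≤n; s≤s; _≡ᵇ_; NonZero)
open import Data.Nat.DivMod using
  (_%_; _/_; _mod_; %-distribˡ-+; m%n%n≡m%n; m<n⇒m%n≡m; n%n≡0; [m+n]%n≡m%n; m%[n*o]/o≡m/o%n)
open import Data.Nat.Properties using (+-suc; +-comm; ≡ᵇ⇒≡; +-commutativeSemigroup)
open import Data.Product using (Σ; ∃-syntax; _×_; _,_; proj₁; proj₂) renaming (map to map×)
open import Data.Sum using (_⊎_; inj₁; inj₂)
open import Data.Unit using (⊤; tt)
open import Data.Vec as Vec using (Vec; []; _∷_; _∷ʳ_; lookup; fromList; toList)
open import Data.Vec.Membership.Propositional using () renaming (_∈_ to _∈ᵛ_)
open import Data.Vec.Relation.Unary.All as Allᵛ using ([]; _∷_)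
import Data.Vec.Relation.Unary.All.Properties as Allᵛ
open import Data.Vec.Relation.Unary.AllPairs using ([]; _∷_)
open import Data.Vec.Relation.Unary.Any using (here; there)
open import Data.Vec.Relation.Unary.Unique.Propositional using (Unique)
open import Data.Vec.Relation.Unary.Unique.Propositional.Properties using (lookup-injective; tabulate⁺)
open import Function using (_∘_; _⇔_; mk⇔; Equivalence)
open import Level using (0ℓ)
open import Relation.Binary using (DecidableEquality)
open import Relation.Binary.Construct.Closure.ReflexiveTransitive using (Star; ε; _◅_; fold)
open import Relation.Binary.PropositionalEquality using
  (_≡_; _≢_; refl; sym; trans; cong; cong₂; subst; module ≡-Reasoning)
open import Relation.Nullary using (¬_; Dec; yes; no; does; proof; ¬?; _×-dec_; contradiction)
open import Relation.Nullary.Decidable using (from-yes)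
open import Relation.Nullary.Reflects using (Reflects; ofʸ; ofⁿ; of; det; ¬-reflects; _×-reflects_; _⊎-reflects_)
open import Relation.Unary using (Pred; Decidable)

open Graph using (V; vertices; edges; Edge; ends)

-- Spanning trees as connected forests

-- Deleting `u 1F` opens the cycle of layers: what is left of layer 1 is the single vertex `v 1F`,
-- adjacent to both ends of the strip. It stays marked throughout, and the sweep starts at layer 0
-- and runs through the layers m - 1, m - 2, ..., 2. Being a zero is not linear in the state, so
-- states cannot be added up before counting. What is linear is the evaluation of a final form at a
-- state. Transporting the form instead makes the count a function on only 32 forms, and the
-- recursion over layers an additive operator on such functions; the nonlinear test for zero occurs
-- only at its base. Modulo 8 this operator kills the initial function in three steps, so a few
-- finite checks cover ladders of every length. The modulus is 8 because the invariant at 2 is the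
-- residue of [Ψ]/4 modulo 2. A further obstacle is that acyclicity is specified through cyclic
-- sequences of vertices and edges, while the sweep adds one edge at a time. It is therefore recast
-- as: each edge joins two components of the edges added before it.

keep : {A : Set} → Bool → A → List A → List A
keep c a as = if c then a ∷ as else as

-- The entries are stacked on `base` instead of being appended, so that `Reach` and `Forest` of a
-- new layer unfold down to the edges passed before.
pick : ∀ {A : Set} {n} → Vec A n → Vec Bool n → List A → List A
pick []       []      base = base
pick (a ∷ as) (c ∷ T) base = keep c a (pick as T base)

module _ {V : Set} (_≟_ : DecidableEquality V) where

  -- Acyclicity in the shape of `Reach`: building the graph from the end of the list, every edge
  -- must merge two components. Loops and parallel edges are excluded as well.
  Forest : List (V × V) → Set
  Forest []             = ⊤
  Forest ((a , b) ∷ es) = ¬ Reach _≟_ es a b × Forest es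

  reach-sym : ∀ es {x y} → Reach _≟_ es x y → Reach _≟_ es y x
  reach-sym []       p                     = sym p
  reach-sym (_ ∷ es) (inj₁ p)              = inj₁ (reach-sym es p)
  reach-sym (_ ∷ es) (inj₂ (inj₁ (p , q))) = inj₂ (inj₂ (reach-sym es q , reach-sym es p))
  reach-sym (_ ∷ es) (inj₂ (inj₂ (p , q))) = inj₂ (inj₁ (reach-sym es q , reach-sym es p))

  reach-⊆ : ∀ es fs → (∀ {e} → e ∈ˡ es → e ∈ˡ fs) → ∀ {x y} → Reach _≟_ es x y → Reach _≟_ fs x y
  reach-⊆ es fs es⊆fs p =
    fold (Reach _≟_ fs) (reach-trans _≟_ fs) (reach-refl _≟_ fs)
      (reach-sound _≟_ es (λ e∈ → reach-step _≟_ fs (inj₁ (es⊆fs e∈)) , reach-step _≟_ fs (inj₂ (es⊆fs e∈))) p)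

  reach-↭ : ∀ {es fs} → es ↭ fs → ∀ {x y} → Reach _≟_ es x y → Reach _≟_ fs x y
  reach-↭ es↭fs = reach-⊆ _ _ (∈-resp-↭ es↭fs)

  -- A cycle through two neighbouring entries is detected at whichever of them comes first: a
  -- connection from `c` to `d` over the edge `ab` is the same cycle as one from `a` to `b` over
  -- `cd`.
  forest-↭ : ∀ {es fs} → es ↭ fs → Forest es → Forest fs
  forest-↭ Perm.refl        F        = F
  forest-↭ (Perm.prep e p)  (¬r , F) = ¬r ∘ reach-↭ (↭-sym p) , forest-↭ p F
  forest-↭ (Perm.trans p q) F        = forest-↭ q (forest-↭ p F)
  forest-↭ {_ ∷ _ ∷ es} {_ ∷ _ ∷ fs} (Perm.swap (a , b) (c , d) p) (¬ab , ¬cd , F) =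
    (λ { (inj₁ r)              → ¬cd (back r)
       ; (inj₂ (inj₁ (r , s))) → ¬ab (inj₂ (inj₁ (reach-sym es (back r) , reach-sym es (back s))))
       ; (inj₂ (inj₂ (r , s))) → ¬ab (inj₂ (inj₂ (back s , back r)))
       }) ,
    (λ r → ¬ab (inj₁ (back r))) , forest-↭ p F
    where
    back : ∀ {x y} → Reach _≟_ fs x y → Reach _≟_ es x y
    back = reach-↭ (↭-sym p)

members : ∀ {n} → Subset n → List (Fin n)
members []            = []
members (outside ∷ T) = map suc (members T)
members (inside  ∷ T) = zero ∷ map suc (members T)

∈-members⁺ : ∀ {n} {T : Subset n} {i} → i ∈ T → i ∈ˡ members T
∈-members⁺ Vec.here = here refl
∈-members⁺ {T = outside ∷ T} (Vec.there i∈) = ∈-map⁺ suc (∈-members⁺ i∈)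
∈-members⁺ {T = inside  ∷ T} (Vec.there i∈) = there (∈-map⁺ suc (∈-members⁺ i∈))

∈-members⁻ : ∀ {n} (T : Subset n) {i} → i ∈ˡ members T → i ∈ T
∈-members⁻ (outside ∷ T) i∈ with ∈-map⁻ suc i∈
... | j , j∈ , refl = Vec.there (∈-members⁻ T j∈)
∈-members⁻ (inside ∷ T) (here refl) = Vec.here
∈-members⁻ (inside ∷ T) (there i∈) with ∈-map⁻ suc i∈
... | j , j∈ , refl = Vec.there (∈-members⁻ T j∈)

members-unique : ∀ {n} (T : Subset n) → Uniqueˡ.Unique (members T)
members-unique []            = AllPairsˡ.[]
members-unique (outside ∷ T) = Uniqueˡ.map⁺ suc-injective (members-unique T)
members-unique (inside  ∷ T) =
  All.tabulate (λ i∈ 0≡i → let j , _ , eq = ∈-map⁻ suc i∈ in 0≢1+n (trans 0≡i eq)) AllPairsˡ.∷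
  Uniqueˡ.map⁺ suc-injective (members-unique T)

lookup-members : ∀ {A : Set} (as : List A) (T : Subset (length as)) →
                 map (List.lookup as) (members T) ≡ pick (fromList as) T []
lookup-members []       []            = refl
lookup-members (a ∷ as) (outside ∷ T) = trans (sym (map-∘ (members T))) (lookup-members as T)
lookup-members (a ∷ as) (inside  ∷ T) = cong (a ∷_) (trans (sym (map-∘ (members T))) (lookup-members as T))

-- Cyclic indices

mod-cong : ∀ {a b} n .{{_ : NonZero n}} → a % n ≡ b % n → a mod n ≡ b mod n
mod-cong n eq = toℕ-injective (trans (toℕ-fromℕ< _) (trans eq (sym (toℕ-fromℕ< _))))

toℕ-mod : ∀ a n .{{_ : NonZero n}} → toℕ (a mod n) ≡ a % n
toℕ-mod a n = toℕ-fromℕ< _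

next-mod : ∀ a n .{{_ : NonZero n}} → next (a mod n) ≡ suc a mod n
next-mod a n = mod-cong n (begin
  suc (toℕ (a mod n)) % n       ≡⟨ cong (λ k → suc k % n) (toℕ-mod a n) ⟩
  (1 + a % n) % n               ≡⟨ %-distribˡ-+ 1 (a % n) n ⟩
  (1 % n + a % n % n) % n       ≡⟨ cong (λ k → (1 % n + k) % n) (m%n%n≡m%n a n) ⟩
  (1 % n + a % n) % n           ≡⟨ %-distribˡ-+ 1 a n ⟨
  (1 + a) % n                   ∎)
  where open ≡-Reasoning

next-inject₁ : ∀ {n} (i : Fin n) → next (inject₁ i) ≡ suc i
next-inject₁ {n} i = toℕ-injective (begin
  toℕ (next (inject₁ i))         ≡⟨ toℕ-mod (suc (toℕ (inject₁ i))) (suc n) ⟩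
  suc (toℕ (inject₁ i)) % suc n  ≡⟨ cong (λ k → suc k % suc n) (toℕ-inject₁ i) ⟩
  suc (toℕ i) % suc n            ≡⟨ m<n⇒m%n≡m (s≤s (toℕ<n i)) ⟩
  suc (toℕ i)                    ∎)
  where open ≡-Reasoning

next-fromℕ : ∀ n → next (fromℕ n) ≡ zero
next-fromℕ n = toℕ-injective (begin
  toℕ (next (fromℕ n))           ≡⟨ toℕ-mod (suc (toℕ (fromℕ n))) (suc n) ⟩
  suc (toℕ (fromℕ n)) % suc n    ≡⟨ cong (λ k → suc k % suc n) (toℕ-fromℕ n) ⟩
  suc n % suc n                  ≡⟨ n%n≡0 (suc n) ⟩
  0                              ∎)
  where open ≡-Reasoning

-- Going once around ℤ/N from i + 1 returns to i.
around : ∀ {n} (P : Fin (suc n) → Set) (i : Fin (suc n)) →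
         P (next i) → (∀ j → j ≢ i → P j → P (next j)) → P i
around {n} P i start step with go n
  where
  go : ∀ d → P i ⊎ P ((d + suc (toℕ i)) mod suc n)
  go zero = inj₂ start
  go (suc d) with go d
  ... | inj₁ p = inj₁ p
  ... | inj₂ p with (d + suc (toℕ i)) mod suc n ≟ᶠ i
  ...   | yes eq  = inj₁ (subst P eq p)
  ...   | no  neq = inj₂ (subst P (next-mod (d + suc (toℕ i)) (suc n)) (step _ neq p))
... | inj₁ p = p
... | inj₂ p = subst P (toℕ-injective (begin
  toℕ ((n + suc (toℕ i)) mod suc n)  ≡⟨ toℕ-mod (n + suc (toℕ i)) (suc n) ⟩
  (n + suc (toℕ i)) % suc n          ≡⟨ cong (_% suc n) (trans (+-suc n (toℕ i)) (+-comm (suc n) (toℕ i))) ⟩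
  (toℕ i + suc n) % suc n            ≡⟨ [m+n]%n≡m%n (toℕ i) (suc n) ⟩
  toℕ i % suc n                      ≡⟨ m<n⇒m%n≡m (toℕ<n i) ⟩
  toℕ i                              ∎)) p
  where open ≡-Reasoning

lookup-∷ʳ-inject₁ : ∀ {A : Set} {n} (xs : Vec A n) x i → lookup (xs ∷ʳ x) (inject₁ i) ≡ lookup xs i
lookup-∷ʳ-inject₁ (_ ∷ xs) x zero    = refl
lookup-∷ʳ-inject₁ (_ ∷ xs) x (suc i) = lookup-∷ʳ-inject₁ xs x i

lookup-∷ʳ-fromℕ : ∀ {A : Set} {n} (xs : Vec A n) x → lookup (xs ∷ʳ x) (fromℕ n) ≡ x
lookup-∷ʳ-fromℕ []       x = refl
lookup-∷ʳ-fromℕ (_ ∷ xs) x = lookup-∷ʳ-fromℕ xs x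

-- Reconciles the cyclic successor in `IsCycle` with a closed path, whose edges end at the tail of
-- its vertices followed by the starting vertex.
lookup-rotate : ∀ {A : Set} {n} x (xs : Vec A n) i → lookup (xs ∷ʳ x) i ≡ lookup (x ∷ xs) (next i)
lookup-rotate {n = n} x xs i with view i
... | ‵fromℕ   = trans (lookup-∷ʳ-fromℕ xs x) (cong (lookup (x ∷ xs)) (sym (next-fromℕ n)))
... | ‵inj₁ {i = j} _ =
  trans (lookup-∷ʳ-inject₁ xs x j) (cong (lookup (x ∷ xs)) (sym (next-inject₁ j)))

unique-∷ʳ : ∀ {A : Set} {n} {xs : Vec A n} {x} → Unique xs → Allᵛ.All (_≢ x) xs → Unique (xs ∷ʳ x)
unique-∷ʳ []        []        = [] ∷ []
unique-∷ʳ (p ∷ ps)  (q ∷ qs)  = all-∷ʳ p q ∷ unique-∷ʳ ps qs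
  where
  all-∷ʳ : ∀ {A : Set} {P : A → Set} {n} {xs : Vec A n} {x} → Allᵛ.All P xs → P x → Allᵛ.All P (xs ∷ʳ x)
  all-∷ʳ []       q = q ∷ []
  all-∷ʳ (p ∷ ps) q = p ∷ all-∷ʳ ps q

-- Acyclicity by cycles and by components

module _ (G : Graph) where
  open Graph G using (_≟_)

  private
    _⊢_~_ : List (Edge G) → V G → V G → Set
    is ⊢ x ~ y = Reach _≟_ (map (ends G) is) x y

  CycleIn : List (Edge G) → Set
  CycleIn is = ∃[ n ] Σ (Vec (V G) (suc n)) λ xs → Σ (Vec (Edge G) (suc n)) λ es →
    Unique xs × Unique es × (∀ i → lookup es i ∈ˡ is × Joins G (lookup es i) (lookup xs i) (lookup xs (next i)))

  joins⇒reach : ∀ is {e x y} → e ∈ˡ is → Joins G e x y → is ⊢ x ~ y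
  joins⇒reach is {e} e∈ (inj₁ eq) = reach-step _≟_ _ (inj₁ (subst (_∈ˡ map (ends G) is) eq (∈-map⁺ (ends G) e∈)))
  joins⇒reach is {e} e∈ (inj₂ eq) = reach-step _≟_ _ (inj₂ (subst (_∈ˡ map (ends G) is) eq (∈-map⁺ (ends G) e∈)))

  -- If the first edge `e` lies on the cycle, going around from one end of `e` to the other uses
  -- only edges behind `e` in the list, because the edges of a cycle are distinct. So `e` joins two
  -- vertices that are already connected.
  forest⇒acyclic : ∀ is → Forest _≟_ (map (ends G) is) → ¬ CycleIn is
  forest⇒acyclic []       _        (n , xs , es , _ , _ , h) with () ← proj₁ (h zero)
  forest⇒acyclic (e ∷ is) (¬r , F) (n , xs , es , ux , ue , h) with any? (λ i → lookup es i ≟ᶠ e)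
  ... | no e∉ = forest⇒acyclic is F (n , xs , es , ux , ue , λ i → in-tail (λ eq → e∉ (i , eq)) (proj₁ (h i)) , proj₂ (h i))
    where
    in-tail : ∀ {f} → f ≢ e → f ∈ˡ e ∷ is → f ∈ˡ is
    in-tail f≢e (here eq)  = ⊥-elim (f≢e eq)
    in-tail f≢e (there f∈) = f∈
  ... | yes (i , refl) = ¬r (closed (proj₂ (h i)) detour)
    where
    in-tail : ∀ j → j ≢ i → lookup es j ∈ˡ is
    in-tail j j≢i with proj₁ (h j)
    ... | here eq  = ⊥-elim (j≢i (lookup-injective ue j i eq))
    ... | there j∈ = j∈

    detour : is ⊢ lookup xs (next i) ~ lookup xs i
    detour = around (λ j → is ⊢ lookup xs (next i) ~ lookup xs j) i (reach-refl _≟_ _)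
      (λ j j≢i p → reach-trans _≟_ _ p (joins⇒reach is (in-tail j j≢i) (proj₂ (h j))))

    closed : ∀ {x y} → Joins G e x y → is ⊢ y ~ x → is ⊢ proj₁ (ends G e) ~ proj₂ (ends G e)
    closed (inj₁ eq) p rewrite eq = reach-sym _≟_ _ p
    closed (inj₂ eq) p rewrite eq = p

  -- A path x₀, …, xₙ without repeated vertices and the edges it runs along, which all lie in is.
  data Path (is : List (Edge G)) : ∀ {n} → Vec (V G) (suc n) → Vec (Edge G) n → V G → Set where
    stop : ∀ {x} → Path is (x ∷ []) [] x
    step : ∀ {n e x y z} {xs : Vec (V G) n} {es} → e ∈ˡ is → Joins G e x y → Allᵛ.All (x ≢_) (y ∷ xs) →
           Path is (y ∷ xs) es z → Path is (x ∷ y ∷ xs) (e ∷ es) z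

  ∈-or-∉ : ∀ x {n} (ys : Vec (V G) n) → x ∈ᵛ ys ⊎ Allᵛ.All (x ≢_) ys
  ∈-or-∉ x []       = inj₂ []
  ∈-or-∉ x (y ∷ ys) with x ≟ y | ∈-or-∉ x ys
  ... | yes refl | _       = inj₁ (here refl)
  ... | no x≢y   | inj₁ x∈ = inj₁ (there x∈)
  ... | no x≢y   | inj₂ x∉ = inj₂ (x≢y ∷ x∉)

  suffix : ∀ {is n} {xs : Vec (V G) (suc n)} {es x z} → x ∈ᵛ xs → Path is xs es z →
           ∃[ k ] Σ (Vec (V G) k) λ ys → Σ (Vec (Edge G) k) λ fs → Path is (x ∷ ys) fs z
  suffix (here refl) p@stop             = _ , _ , _ , p
  suffix (here refl) p@(step _ _ _ _)   = _ , _ , _ , p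
  suffix (there x∈)  (step _ _ _ p)     = suffix x∈ p

  -- Loop erasure: if the new starting vertex already occurs on the path, the path is cut back to
  -- that occurrence.
  reach⇒path : ∀ {is x z} → Star (λ a b → ∃[ e ] (e ∈ˡ is × Joins G e a b)) x z →
               ∃[ n ] Σ (Vec (V G) n) λ xs → Σ (Vec (Edge G) n) λ es → Path is (x ∷ xs) es z
  reach⇒path ε = _ , _ , _ , stop
  reach⇒path {x = x} (_◅_ {j = y} (e , e∈ , eJ) rest) with reach⇒path rest
  ... | _ , ys , es , p with ∈-or-∉ x (y ∷ ys)
  ...   | inj₁ x∈ = suffix x∈ p
  ...   | inj₂ x∉ = _ , _ , _ , step e∈ eJ x∉ p

  path-vertices-unique : ∀ {is n} {xs : Vec (V G) (suc n)} {es z} → Path is xs es z → Unique xs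
  path-vertices-unique stop            = [] ∷ []
  path-vertices-unique (step _ _ x∉ p) = x∉ ∷ path-vertices-unique p

  same-end : ∀ {e x y a b} → Joins G e x y → Joins G e a b → x ≡ a ⊎ x ≡ b
  same-end (inj₁ eq) (inj₁ eq') = inj₁ (cong proj₁ (trans (sym eq) eq'))
  same-end (inj₁ eq) (inj₂ eq') = inj₂ (cong proj₁ (trans (sym eq) eq'))
  same-end (inj₂ eq) (inj₁ eq') = inj₂ (cong proj₂ (trans (sym eq) eq'))
  same-end (inj₂ eq) (inj₂ eq') = inj₁ (cong proj₂ (trans (sym eq) eq'))

  -- Both ends of every edge of the path lie on the path, so an edge with an end off the path
  -- differs from all of them. This derives distinct edges from distinct vertices.
  path-avoids : ∀ {is n} {xs : Vec (V G) (suc n)} {es z e x y} → Joins G e x y → Allᵛ.All (x ≢_) xs →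
                Path is xs es z → Allᵛ.All (e ≢_) es
  path-avoids J _                   stop            = []
  path-avoids J (x≢a ∷ x∉@(x≢b ∷ _)) (step _ J' _ p) = (λ { refl → differ (same-end J J') }) ∷ path-avoids J x∉ p
    where
    differ : _ ⊎ _ → ⊥
    differ (inj₁ x≡a) = x≢a x≡a
    differ (inj₂ x≡b) = x≢b x≡b

  path-edges-unique : ∀ {is n} {xs : Vec (V G) (suc n)} {es z} → Path is xs es z → Unique es
  path-edges-unique stop            = []
  path-edges-unique (step _ J x∉ p) = path-avoids J x∉ p ∷ path-edges-unique p

  path-edges∈ : ∀ {is n} {xs : Vec (V G) (suc n)} {es z} → Path is xs es z → Allᵛ.All (_∈ˡ is) es
  path-edges∈ stop            = []
  path-edges∈ (step e∈ _ _ p) = e∈ ∷ path-edges∈ p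

  -- The vertex `a` is arbitrary, since the induction shortens the path from its start; only the
  -- application takes `a` to be the starting vertex.
  close : ∀ {is n x} {xs : Vec (V G) n} {es z e a} → Path is (x ∷ xs) es z → Joins G e z a →
          ∀ i → lookup (es ∷ʳ e) i ∈ˡ e ∷ is × Joins G (lookup (es ∷ʳ e) i) (lookup (x ∷ xs) i) (lookup (xs ∷ʳ a) i)
  close stop             J zero    = here refl , J
  close (step e∈ J' _ p) J zero    = there e∈ , J'
  close (step _ _ _ p)   J (suc i) = close p J i

  -- If the ends of `e` were connected by edges behind it, a path between them would close up with
  -- `e`. An empty path gives the cycle of a loop, a single edge that of a parallel pair.
  acyclic⇒forest : ∀ is → Uniqueˡ.Unique is → ¬ CycleIn is → Forest _≟_ (map (ends G) is)
  acyclic⇒forest []       _             _      = tt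
  acyclic⇒forest (e ∷ is) (e∉ AllPairsˡ.∷ unique) ¬cycle =
    no-reach ,
    acyclic⇒forest is unique (λ { (n , xs , es , ux , ue , h) → ¬cycle (n , xs , es , ux , ue , λ i → there (proj₁ (h i)) , proj₂ (h i)) })
    where
    adjacent : ∀ {x y} → (x , y) ∈ˡ map (ends G) is →
               (∃[ f ] (f ∈ˡ is × Joins G f x y)) × (∃[ f ] (f ∈ˡ is × Joins G f y x))
    adjacent p with ∈-map⁻ (ends G) p
    ... | f , f∈ , eq = (f , f∈ , inj₁ (sym eq)) , (f , f∈ , inj₂ (sym eq))

    no-reach : ¬ is ⊢ proj₁ (ends G e) ~ proj₂ (ends G e)
    no-reach r with reach⇒path (reach-sound _≟_ (map (ends G) is) adjacent r)
    ... | n , xs , es , p = ¬cycle (n , _ , es ∷ʳ e , path-vertices-unique p ,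
      unique-∷ʳ (path-edges-unique p) (Allᵛ.map (λ f∈ f≡e → All.lookup e∉ f∈ (sym f≡e)) (path-edges∈ p)) ,
      λ i → let e∈ , J = close p (inj₂ refl) i in e∈ , subst (Joins G _ _) (lookup-rotate _ xs i) J)

  module _ (T : Subset (length (edges G))) where
    private
      picked : List (V G × V G)
      picked = pick (fromList (edges G)) T []

    Spanning : Set
    Spanning = Forest _≟_ picked × (∀ {x y} → x ∈ˡ vertices G → y ∈ˡ vertices G → Reach _≟_ picked x y)

    private
      adj⇒reach : ∀ {x y} → Adj G T x y → Reach _≟_ picked x y
      adj⇒reach (e , e∈ , J) = subst (λ es → Reach _≟_ es _ _) (lookup-members (edges G) T)
        (joins⇒reach (members T) (∈-members⁺ e∈) J)

      reach⇒star : ∀ {x y} → Reach _≟_ picked x y → Star (Adj G T) x y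
      reach⇒star = reach-sound _≟_ picked λ p →
        let e , e∈ , eq = ∈-map⁻ (ends G) (subst (_ ∈ˡ_) (sym (lookup-members (edges G) T)) p)
        in (e , ∈-members⁻ T e∈ , inj₁ (sym eq)) , (e , ∈-members⁻ T e∈ , inj₂ (sym eq))

      star⇒reach : ∀ {x y} → Star (Adj G T) x y → Reach _≟_ picked x y
      star⇒reach = fold (Reach _≟_ picked) (λ a r → reach-trans _≟_ picked (adj⇒reach a) r) (reach-refl _≟_ picked)

    isSpanningTree⇔spanning : IsSpanningTree G T ⇔ Spanning
    isSpanningTree⇔spanning = mk⇔
      (λ (connected , acyclic) →
        subst (Forest _≟_) (lookup-members (edges G) T)
          (acyclic⇒forest (members T) (members-unique T)
            (λ { (n , xs , es , ux , ue , h) → acyclic (n , xs , es , ux , ue , λ i → ∈-members⁻ T (proj₁ (h i)) , proj₂ (h i)) })) ,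
        λ x∈ y∈ → star⇒reach (All.lookup (All.lookup connected x∈) y∈))
      (λ (forest , reach) →
        All.tabulate (λ x∈ → All.tabulate (λ y∈ → reach⇒star (reach x∈ y∈))) ,
        λ { (n , xs , es , ux , ue , h) →
          forest⇒acyclic (members T) (subst (Forest _≟_) (sym (lookup-members (edges G) T)) forest)
            (n , xs , es , ux , ue , λ i → ∈-members⁺ (proj₁ (h i)) , proj₂ (h i)) })

-- The sweep

reflects-⇔ : ∀ {A B : Set} {b} → (A → B) → (B → A) → Reflects A b → Reflects B b
reflects-⇔ to from (ofʸ a)  = of (to a)
reflects-⇔ to from (ofⁿ ¬a) = of (¬a ∘ from)

-- Connectivity matrices of n marked vertices.
Mat : ℕ → Set
Mat n = Fin n → Fin n → Bool

-- The effect of an additional edge between the marked vertices a and b; compare Reach.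
join : ∀ {n} → Fin n → Fin n → Mat n → Mat n
join a b M p q = M p q ∨ (M p a ∧ M b q) ∨ (M p b ∧ M a q)

-- The second component tells whether every added edge joined two components.
adjoin : ∀ {n k} → Vec (Fin n × Fin n) k → Vec Bool k → Mat n → Mat n × Bool
adjoin []             []          M = M , true
adjoin (e       ∷ es) (false ∷ c) M = adjoin es c M
adjoin ((a , b) ∷ es) (true ∷ c)  M = let N , independent = adjoin es c M in join a b N , not (N a b) ∧ independent

isolate : ∀ {n} → Mat n → Mat (suc n)
isolate M zero    zero    = true
isolate M zero    (suc q) = false
isolate M (suc p) zero    = false
isolate M (suc p) (suc q) = M p q

tri : Bool → Bool → Bool → Mat 3
tri tx ty xy 0F 1F = tx
tri tx ty xy 1F 0F = tx
tri tx ty xy 0F 2F = ty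
tri tx ty xy 2F 0F = ty
tri tx ty xy 1F 2F = xy
tri tx ty xy 2F 1F = xy
tri tx ty xy 0F 0F = true
tri tx ty xy 1F 1F = true
tri tx ty xy 2F 2F = true

-- x∣ty: x is alone, t and y are connected.
data Partition : Set where
  txy t∣xy x∣ty y∣tx t∣x∣y : Partition

mat : Partition → Mat 3
mat txy   = tri true  true  true
mat t∣xy  = tri false false true
mat x∣ty  = tri false true  false
mat y∣tx  = tri true  false false
mat t∣x∣y = tri false false false

-- The arguments tell whether t and x, t and y, x and y are connected. Once t is connected to x or
-- y, transitivity determines the third.
classify : Bool → Bool → Bool → Partition
classify true  true  _     = txy
classify true  false _     = y∣tx
classify false true  _     = x∣ty
classify false false true  = t∣xy
classify false false false = t∣x∣y

-- Marked vertices a, b, t, x, y, in this order.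
layer : Vec (Fin 5 × Fin 5) 4
layer = (0F , 3F) ∷ (0F , 4F) ∷ (1F , 3F) ∷ (1F , 4F) ∷ []

anchored : Mat 5 → Fin 5 → Bool
anchored M z = M z 2F ∨ M z 0F ∨ M z 1F

-- Only `x` and `y` need testing: every vertex passed earlier is already connected to one of `t`,
-- `x`, `y`, and `t` remains available.
resolve : Mat 5 × Bool → Maybe Partition
resolve (M , independent) =
  if independent ∧ anchored M 3F ∧ anchored M 4F then just (classify (M 2F 0F) (M 2F 1F) (M 0F 1F)) else nothing

-- nothing: the chosen edges contain a cycle or leave a component that can no
-- longer be connected to the rest.
advance : Vec Bool 4 → Partition → Maybe Partition
advance c π = resolve (adjoin layer c (isolate (isolate (mat π))))

spokes : Vec (Fin 3 × Fin 3) 2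
spokes = (1F , 0F) ∷ (2F , 0F) ∷ []

-- Nothing can fail here: two edges from `t` to distinct vertices form a forest, and no vertex has
-- been left behind.
start : Vec Bool 2 → Partition
start c = let M , _ = adjoin spokes c (mat t∣x∣y) in classify (M 0F 1F) (M 0F 2F) (M 1F 2F)

tips : Vec (Fin 3 × Fin 3) 2
tips = (0F , 1F) ∷ (0F , 2F) ∷ []

finish : Vec Bool 2 → Partition → Bool
finish c π = let M , independent = adjoin tips c (mat π) in independent ∧ M 0F 1F ∧ M 0F 2F

-- Correctness of the sweep for arbitrary vertices

module _ {V : Set} (_≟_ : DecidableEquality V) where
  private
    _⊢_~_ : List (V × V) → V → V → Set
    es ⊢ x ~ y = Reach _≟_ es x y

  Models : ∀ {n} → Mat n → Vec V n → List (V × V) → Set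
  Models M zs es = ∀ p q → Reflects (Reach _≟_ es (lookup zs p) (lookup zs q)) (M p q)

  pickAt : ∀ {n k} → Vec V n → Vec (Fin n × Fin n) k → Vec Bool k → List (V × V) → List (V × V)
  pickAt zs fs = pick (Vec.map (map× (lookup zs) (lookup zs)) fs)

  adjoin-models : ∀ {n k M es} (zs : Vec V n) (fs : Vec (Fin n × Fin n) k) c → Models M zs es →
                  Models (proj₁ (adjoin fs c M)) zs (pickAt zs fs c es)
  adjoin-models zs []             []          m = m
  adjoin-models zs (_ ∷ fs)       (false ∷ c) m = adjoin-models zs fs c m
  adjoin-models zs ((a , b) ∷ fs) (true ∷ c)  m p q =
    let m' = adjoin-models zs fs c m
    in m' p q ⊎-reflects ((m' p a ×-reflects m' b q) ⊎-reflects (m' p b ×-reflects m' a q))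

  adjoin-independent : ∀ {n k M es} (zs : Vec V n) (fs : Vec (Fin n × Fin n) k) c → Models M zs es →
                       Forest _≟_ es → Reflects (Forest _≟_ (pickAt zs fs c es)) (proj₂ (adjoin fs c M))
  adjoin-independent zs []             []          m F = of F
  adjoin-independent zs (_ ∷ fs)       (false ∷ c) m F = adjoin-independent zs fs c m F
  adjoin-independent zs ((a , b) ∷ fs) (true ∷ c)  m F =
    ¬-reflects (adjoin-models zs fs c m a b) ×-reflects adjoin-independent zs fs c m F

  pick-forest : ∀ {n k} (zs : Vec V n) (fs : Vec (Fin n × Fin n) k) c es → Forest _≟_ (pickAt zs fs c es) → Forest _≟_ es
  pick-forest zs []       []          es F       = F
  pick-forest zs (_ ∷ fs) (false ∷ c) es F       = pick-forest zs fs c es F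
  pick-forest zs (_ ∷ fs) (true ∷ c)  es (_ , F) = pick-forest zs fs c es F

  pick-reach : ∀ {n k} (zs : Vec V n) (fs : Vec (Fin n × Fin n) k) c es {x y} → es ⊢ x ~ y → pickAt zs fs c es ⊢ x ~ y
  pick-reach zs []       []          es r = r
  pick-reach zs (_ ∷ fs) (false ∷ c) es r = pick-reach zs fs c es r
  pick-reach zs (_ ∷ fs) (true ∷ c)  es r = inj₁ (pick-reach zs fs c es r)

  Isolated : List (V × V) → V → Set
  Isolated es a = ∀ {z} → es ⊢ a ~ z → a ≡ z

  isolate-models : ∀ {n M es a} (zs : Vec V n) → Isolated es a → (∀ p → a ≢ lookup zs p) →
                   Models M zs es → Models (isolate M) (a ∷ zs) es
  isolate-models {es = es} zs iso a≢ m zero    zero    = of (reach-refl _≟_ es)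
  isolate-models {es = es} zs iso a≢ m zero    (suc q) = of (λ r → a≢ q (iso r))
  isolate-models {es = es} zs iso a≢ m (suc p) zero    = of (λ r → a≢ p (iso (reach-sym _≟_ es r)))
  isolate-models zs iso a≢ m (suc p) (suc q) = m p q

  tri-models : ∀ {es t x y tx ty xy} → Reflects (es ⊢ t ~ x) tx → Reflects (es ⊢ t ~ y) ty → Reflects (es ⊢ x ~ y) xy →
               Models (tri tx ty xy) (t ∷ x ∷ y ∷ []) es
  tri-models {es} {t} {x} {y} rtx rty rxy = m
    where
    flip : ∀ {a b c} → Reflects (es ⊢ a ~ b) c → Reflects (es ⊢ b ~ a) c
    flip (ofʸ r)  = of (reach-sym _≟_ es r)
    flip (ofⁿ ¬r) = of (λ r → ¬r (reach-sym _≟_ es r))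

    m : Models (tri _ _ _) (t ∷ x ∷ y ∷ []) es
    m 0F 0F = of (reach-refl _≟_ es)
    m 1F 1F = of (reach-refl _≟_ es)
    m 2F 2F = of (reach-refl _≟_ es)
    m 0F 1F = rtx
    m 1F 0F = flip rtx
    m 0F 2F = rty
    m 2F 0F = flip rty
    m 1F 2F = rxy
    m 2F 1F = flip rxy

  classify-models : ∀ {es t x y tx ty xy} →
    Reflects (es ⊢ t ~ x) tx → Reflects (es ⊢ t ~ y) ty → Reflects (es ⊢ x ~ y) xy →
    Models (mat (classify tx ty xy)) (t ∷ x ∷ y ∷ []) es
  classify-models {es} rtx@(ofʸ tx)  rty@(ofʸ ty)  _ =
    tri-models rtx rty (of (reach-trans _≟_ es (reach-sym _≟_ es tx) ty))
  classify-models {es} rtx@(ofʸ tx)  rty@(ofⁿ ¬ty) _ =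
    tri-models rtx rty (of (λ xy → ¬ty (reach-trans _≟_ es tx xy)))
  classify-models {es} rtx@(ofⁿ ¬tx) rty@(ofʸ ty)  _ =
    tri-models rtx rty (of (λ xy → ¬tx (reach-trans _≟_ es ty (reach-sym _≟_ es xy))))
  classify-models rtx@(ofⁿ _) rty@(ofⁿ _) rxy@(ofʸ _) = tri-models rtx rty rxy
  classify-models rtx@(ofⁿ _) rty@(ofⁿ _) rxy@(ofⁿ _) = tri-models rtx rty rxy

  -- t, x and y are the vertices at which further edges may be attached.
  Extendable : (t x y : V) (vs : List V) → List (V × V) → Set
  Extendable t x y vs es = Forest _≟_ es × All (λ z → es ⊢ z ~ t ⊎ es ⊢ z ~ x ⊎ es ⊢ z ~ y) vs

  -- The case `nothing` is a refutation rather than a mere failure: `accepted` has to decide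
  -- spanning trees, so a discarded choice must be shown never to become one.
  Describes : (t x y : V) (vs : List V) → List (V × V) → Maybe Partition → Set
  Describes t x y vs es (just π) = Extendable t x y vs es × Models (mat π) (t ∷ x ∷ y ∷ []) es
  Describes t x y vs es nothing  = ¬ Extendable t x y vs es

  -- A walk leaving the component of z in es does so from an end of one of the added edges.
  pick-exit : ∀ {k n} (zs : Vec V n) (fs : Vec (Fin n × Fin n) k) c es {z w} → pickAt zs fs c es ⊢ z ~ w →
              es ⊢ z ~ w ⊎ ∃[ p ] es ⊢ z ~ lookup zs p
  pick-exit zs []             []          es r        = inj₁ r
  pick-exit zs (_ ∷ fs)       (false ∷ c) es r        = pick-exit zs fs c es r
  pick-exit zs (_ ∷ fs)       (true ∷ c)  es (inj₁ r) = pick-exit zs fs c es r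
  pick-exit zs ((a , _) ∷ fs) (true ∷ c)  es (inj₂ (inj₁ (r , _))) with pick-exit zs fs c es r
  ... | inj₁ r' = inj₂ (a , r')
  ... | inj₂ r' = inj₂ r'
  pick-exit zs ((_ , b) ∷ fs) (true ∷ c)  es (inj₂ (inj₂ (r , _))) with pick-exit zs fs c es r
  ... | inj₁ r' = inj₂ (b , r')
  ... | inj₂ r' = inj₂ r'

  -- Failure persists because extendability passes back to `es`: a covered vertex that reaches `t`,
  -- `a` or `b` after the layer reaches some marked vertex within `es`, and this is not `a` or `b`,
  -- which are isolated there. In the other direction, covered vertices that hung on `x` or `y`
  -- inherit the anchors of `x` and `y`.
  advance-describes : ∀ {t x y a b vs es} c s → x ∈ˡ vs → y ∈ˡ vs → a ≢ b →
    All (a ≢_) (t ∷ vs) → All (b ≢_) (t ∷ vs) → Isolated es a → Isolated es b → Describes t x y vs es s →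
    Describes t a b (a ∷ b ∷ vs) (pickAt (a ∷ b ∷ t ∷ x ∷ y ∷ []) layer c es) (s >>= advance c)
  advance-describes {t} {x} {y} {a} {b} {vs} {es} c s x∈ y∈ a≢b (a≢t ∷ a∉) (b≢t ∷ b∉) ia ib d = go s d
    where
    zs : Vec V 5
    zs = a ∷ b ∷ t ∷ x ∷ y ∷ []

    fs : List (V × V)
    fs = pickAt zs layer c es

    Anchor : V → Set
    Anchor z = fs ⊢ z ~ t ⊎ fs ⊢ z ~ a ⊎ fs ⊢ z ~ b

    shrink : Extendable t a b (a ∷ b ∷ vs) fs → Extendable t x y vs es
    shrink (F , _ ∷ _ ∷ anchors) = pick-forest zs layer c es F , All.tabulate λ z∈ → old z∈ (All.lookup anchors z∈)
      where
      marked : ∀ {z} → z ∈ˡ vs → (∃[ p ] es ⊢ z ~ lookup zs p) → es ⊢ z ~ t ⊎ es ⊢ z ~ x ⊎ es ⊢ z ~ y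
      marked z∈ (0F , r) = contradiction (ia (reach-sym _≟_ es r)) (All.lookup a∉ z∈)
      marked z∈ (1F , r) = contradiction (ib (reach-sym _≟_ es r)) (All.lookup b∉ z∈)
      marked z∈ (2F , r) = inj₁ r
      marked z∈ (3F , r) = inj₂ (inj₁ r)
      marked z∈ (4F , r) = inj₂ (inj₂ r)

      exit : ∀ {z} p → z ∈ˡ vs → fs ⊢ z ~ lookup zs p → es ⊢ z ~ t ⊎ es ⊢ z ~ x ⊎ es ⊢ z ~ y
      exit p z∈ r with pick-exit zs layer c es r
      ... | inj₁ r' = marked z∈ (p , r')
      ... | inj₂ r' = marked z∈ r'

      old : ∀ {z} → z ∈ˡ vs → Anchor z → es ⊢ z ~ t ⊎ es ⊢ z ~ x ⊎ es ⊢ z ~ y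
      old z∈ (inj₁ r)        = exit 2F z∈ r
      old z∈ (inj₂ (inj₁ r)) = exit 0F z∈ r
      old z∈ (inj₂ (inj₂ r)) = exit 1F z∈ r

    go : ∀ s → Describes t x y vs es s → Describes t a b (a ∷ b ∷ vs) fs (s >>= advance c)
    go nothing  ¬E                  = ¬E ∘ shrink
    go (just π) ((F , anchors) , m) = decide (adjoin-independent zs layer c m₅ F ×-reflects (anchor 3F ×-reflects anchor 4F))
      where
      a≢ : ∀ p → a ≢ lookup (b ∷ t ∷ x ∷ y ∷ []) p
      a≢ 0F = a≢b
      a≢ 1F = a≢t
      a≢ 2F = All.lookup a∉ x∈
      a≢ 3F = All.lookup a∉ y∈

      b≢ : ∀ p → b ≢ lookup (t ∷ x ∷ y ∷ []) p
      b≢ 0F = b≢t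
      b≢ 1F = All.lookup b∉ x∈
      b≢ 2F = All.lookup b∉ y∈

      N : Mat 5
      N = proj₁ (adjoin layer c (isolate (isolate (mat π))))

      m₅ : Models (isolate (isolate (mat π))) zs es
      m₅ = isolate-models _ ia a≢ (isolate-models (t ∷ x ∷ y ∷ []) ib b≢ m)

      n₅ : Models N zs fs
      n₅ = adjoin-models zs layer c m₅

      anchor : ∀ p → Reflects (Anchor (lookup zs p)) (anchored N p)
      anchor p = n₅ p 2F ⊎-reflects (n₅ p 0F ⊎-reflects n₅ p 1F)

      via : ∀ {z w} → es ⊢ z ~ w → Anchor w → Anchor z
      via r (inj₁ q)        = inj₁ (reach-trans _≟_ fs (pick-reach zs layer c es r) q)
      via r (inj₂ (inj₁ q)) = inj₂ (inj₁ (reach-trans _≟_ fs (pick-reach zs layer c es r) q))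
      via r (inj₂ (inj₂ q)) = inj₂ (inj₂ (reach-trans _≟_ fs (pick-reach zs layer c es r) q))

      relay : Anchor x → Anchor y → ∀ {z} → es ⊢ z ~ t ⊎ es ⊢ z ~ x ⊎ es ⊢ z ~ y → Anchor z
      relay ax ay (inj₁ r)        = inj₁ (pick-reach zs layer c es r)
      relay ax ay (inj₂ (inj₁ r)) = via r ax
      relay ax ay (inj₂ (inj₂ r)) = via r ay

      decide : ∀ {d} → Reflects (Forest _≟_ fs × Anchor x × Anchor y) d →
               Describes t a b (a ∷ b ∷ vs) fs (if d then just (classify (N 2F 0F) (N 2F 1F) (N 0F 1F)) else nothing)
      decide (ofʸ (F' , ax , ay)) =
        (F' , inj₂ (inj₁ (reach-refl _≟_ fs)) ∷ inj₂ (inj₂ (reach-refl _≟_ fs)) ∷ All.map (relay ax ay) anchors) ,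
        classify-models (n₅ 2F 0F) (n₅ 2F 1F) (n₅ 0F 1F)
      decide (ofⁿ ¬E) = λ { (F' , _ ∷ _ ∷ anchors') → ¬E (F' , All.lookup anchors' x∈ , All.lookup anchors' y∈) }

  finish-reflects : ∀ {t x y vs es} c s → x ∈ˡ vs → y ∈ˡ vs → Describes t x y vs es s →
    Reflects (Forest _≟_ (pickAt (t ∷ x ∷ y ∷ []) tips c es) × All (λ z → pickAt (t ∷ x ∷ y ∷ []) tips c es ⊢ z ~ t) vs)
             (maybe′ (finish c) false s)
  finish-reflects {t} {x} {y} {vs} {es} c s x∈ y∈ d = go s d
    where
    zs : Vec V 3
    zs = t ∷ x ∷ y ∷ []

    fs : List (V × V)
    fs = pickAt zs tips c es

    shrink : Forest _≟_ fs × All (λ z → fs ⊢ z ~ t) vs → Extendable t x y vs es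
    shrink (F , reach) = pick-forest zs tips c es F , All.map old reach
      where
      old : ∀ {z} → fs ⊢ z ~ t → es ⊢ z ~ t ⊎ es ⊢ z ~ x ⊎ es ⊢ z ~ y
      old r with pick-exit zs tips c es r
      ... | inj₁ r'        = inj₁ r'
      ... | inj₂ (0F , r') = inj₁ r'
      ... | inj₂ (1F , r') = inj₂ (inj₁ r')
      ... | inj₂ (2F , r') = inj₂ (inj₂ r')

    go : ∀ s → Describes t x y vs es s →
         Reflects (Forest _≟_ fs × All (λ z → fs ⊢ z ~ t) vs) (maybe′ (finish c) false s)
    go nothing  ¬E                  = of (¬E ∘ shrink)
    go (just π) ((F , anchors) , m) = reflects-⇔ to from
      (adjoin-independent zs tips c m F ×-reflects (n 0F 1F ×-reflects n 0F 2F))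
      where
      n : Models (proj₁ (adjoin tips c (mat π))) zs fs
      n = adjoin-models zs tips c m

      to : Forest _≟_ fs × fs ⊢ t ~ x × fs ⊢ t ~ y → Forest _≟_ fs × All (λ z → fs ⊢ z ~ t) vs
      to (F' , tx , ty) = F' , All.map relay anchors
        where
        relay : ∀ {z} → es ⊢ z ~ t ⊎ es ⊢ z ~ x ⊎ es ⊢ z ~ y → fs ⊢ z ~ t
        relay (inj₁ r)        = pick-reach zs tips c es r
        relay (inj₂ (inj₁ r)) = reach-trans _≟_ fs (pick-reach zs tips c es r) (reach-sym _≟_ fs tx)
        relay (inj₂ (inj₂ r)) = reach-trans _≟_ fs (pick-reach zs tips c es r) (reach-sym _≟_ fs ty)

      from : Forest _≟_ fs × All (λ z → fs ⊢ z ~ t) vs → Forest _≟_ fs × fs ⊢ t ~ x × fs ⊢ t ~ y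
      from (F' , reach) = F' , reach-sym _≟_ fs (All.lookup reach x∈) , reach-sym _≟_ fs (All.lookup reach y∈)

  start-describes : ∀ {t x y} → t ≢ x → t ≢ y → x ≢ y → ∀ c →
    Describes t x y (x ∷ y ∷ []) (pickAt (t ∷ x ∷ y ∷ []) spokes c []) (just (start c))
  start-describes {t} {x} {y} t≢x t≢y x≢y c =
    (forest c , inj₂ (inj₁ (reach-refl _≟_ es)) ∷ inj₂ (inj₂ (reach-refl _≟_ es)) ∷ []) ,
    classify-models (m 0F 1F) (m 0F 2F) (m 1F 2F)
    where
    es : List (V × V)
    es = pickAt (t ∷ x ∷ y ∷ []) spokes c []

    m : Models (proj₁ (adjoin spokes c (mat t∣x∣y))) (t ∷ x ∷ y ∷ []) es
    m = adjoin-models (t ∷ x ∷ y ∷ []) spokes c (tri-models (of t≢x) (of t≢y) (of x≢y))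

    forest : ∀ c → Forest _≟_ (pickAt (t ∷ x ∷ y ∷ []) spokes c [])
    forest (false ∷ false ∷ []) = tt
    forest (false ∷ true ∷ [])  = t≢y ∘ sym , tt
    forest (true ∷ false ∷ [])  = t≢x ∘ sym , tt
    forest (true ∷ true ∷ [])   =
      (λ { (inj₁ x≡t)              → t≢x (sym x≡t)
         ; (inj₂ (inj₁ (x≡y , _))) → x≢y x≡y
         ; (inj₂ (inj₂ (x≡t , _))) → t≢x (sym x≡t) }) , t≢y ∘ sym , tt

pick-++ : ∀ {A : Set} {n} (as : Vec A n) T base → pick as T base ≡ pick as T [] ++ base
pick-++ []       []          base = refl
pick-++ (a ∷ as) (false ∷ T) base = pick-++ as T base
pick-++ (a ∷ as) (true ∷ T)  base = cong (a ∷_) (pick-++ as T base)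

-- The edge list of the graph begins with the edges as, which the sweep passes first, hence last in the list.
pick-rotate : ∀ {A : Set} {k l n} (as : Vec A k) (bs : Vec A l) (cs : Vec A n) s c T →
              pick as s (pick bs c (pick cs T [])) ↭ pick bs c (pick cs T (pick as s []))
pick-rotate as bs cs s c T
  rewrite pick-++ as s (pick bs c (pick cs T [])) | pick-++ bs c (pick cs T [])
        | pick-++ bs c (pick cs T (pick as s [])) | pick-++ cs T (pick as s [])
        | sym (++-assoc (pick bs c []) (pick cs T []) (pick as s []))
  = ++-comm (pick as s []) (pick bs c [] ++ pick cs T [])

-- The head of the vector belongs to the layer passed last.
run : ∀ k → Vec Bool (k * 4) → Partition → Maybe Partition
run zero    []                        π = just π
run (suc k) (c₀ ∷ c₁ ∷ c₂ ∷ c₃ ∷ T) π = run k T π >>= advance (c₀ ∷ c₁ ∷ c₂ ∷ c₃ ∷ [])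

accepted : ∀ k → Vec Bool 2 → Vec Bool 2 → Vec Bool (k * 4) → Bool
accepted k s c T = maybe′ (finish c) false (run k T (start s))

-- The sweep on the ladder

module _ {m : ℕ} where
  private
    Node : Set
    Node = XVertex m

  top : ∀ {k} → Vec (Fin m) k → Fin m → Fin m
  top []      z = z
  top (i ∷ _) z = i

  -- The successor of a layer is read off the vector, with `z` closing it, so no arithmetic modulo m
  -- enters the induction over layers.
  rungs : ∀ {k} → Vec (Fin m) k → Fin m → Vec (Node × Node) (k * 4)
  rungs []       z = []
  rungs (i ∷ is) z =
    (u i , u (top is z)) ∷ (u i , v (top is z)) ∷ (v i , u (top is z)) ∷ (v i , v (top is z)) ∷ rungs is z

  covered : ∀ {k} → Vec (Fin m) k → Fin m → List Node
  covered []       z = u z ∷ v z ∷ []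
  covered (i ∷ is) z = u i ∷ v i ∷ covered is z

  u-top∈ : ∀ {k} (is : Vec (Fin m) k) z → u (top is z) ∈ˡ covered is z
  u-top∈ []      z = here refl
  u-top∈ (_ ∷ _) z = here refl

  v-top∈ : ∀ {k} (is : Vec (Fin m) k) z → v (top is z) ∈ˡ covered is z
  v-top∈ []      z = there (here refl)
  v-top∈ (_ ∷ _) z = there (here refl)

  u-last∈ : ∀ {k} (is : Vec (Fin m) k) z → u z ∈ˡ covered is z
  u-last∈ []       z = here refl
  u-last∈ (_ ∷ is) z = there (there (u-last∈ is z))

  v-last∈ : ∀ {k} (is : Vec (Fin m) k) z → v z ∈ˡ covered is z
  v-last∈ []       z = there (here refl)
  v-last∈ (_ ∷ is) z = there (there (v-last∈ is z))

  u-tabulate∈ : ∀ {k} (f : Fin k → Fin m) z j → u (f j) ∈ˡ covered (Vec.tabulate f) z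
  u-tabulate∈ f z zero    = here refl
  u-tabulate∈ f z (suc j) = there (there (u-tabulate∈ (f ∘ suc) z j))

  v-tabulate∈ : ∀ {k} (f : Fin k → Fin m) z j → v (f j) ∈ˡ covered (Vec.tabulate f) z
  v-tabulate∈ f z zero    = there (here refl)
  v-tabulate∈ f z (suc j) = there (there (v-tabulate∈ (f ∘ suc) z j))

  u∉covered : ∀ {k i z} {is : Vec (Fin m) k} → i ≢ z → Allᵛ.All (i ≢_) is → All (u i ≢_) (covered is z)
  u∉covered i≢z []          = (λ { refl → i≢z refl }) ∷ (λ ()) ∷ []
  u∉covered i≢z (i≢j ∷ i∉) = (λ { refl → i≢j refl }) ∷ (λ ()) ∷ u∉covered i≢z i∉

  v∉covered : ∀ {k i z} {is : Vec (Fin m) k} → i ≢ z → Allᵛ.All (i ≢_) is → All (v i ≢_) (covered is z)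
  v∉covered i≢z []          = (λ ()) ∷ (λ { refl → i≢z refl }) ∷ []
  v∉covered i≢z (i≢j ∷ i∉) = (λ ()) ∷ (λ { refl → i≢j refl }) ∷ v∉covered i≢z i∉

  isolated-pick : ∀ {n a es} (fs : Vec (Node × Node) n) T → Allᵛ.All (λ e → a ≢ proj₁ e × a ≢ proj₂ e) fs →
                  Isolated _≟ˣ_ es a → Isolated _≟ˣ_ (pick fs T es) a
  isolated-pick []       []          []               iso r                     = iso r
  isolated-pick (_ ∷ fs) (false ∷ T) (_ ∷ avoid)      iso r                     = isolated-pick fs T avoid iso r
  isolated-pick (_ ∷ fs) (true ∷ T)  (_ ∷ avoid)      iso (inj₁ r)              = isolated-pick fs T avoid iso r
  isolated-pick (_ ∷ fs) (true ∷ T)  ((a≢ , _) ∷ avoid) iso (inj₂ (inj₁ (r , _))) =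
    contradiction (isolated-pick fs T avoid iso r) a≢
  isolated-pick (_ ∷ fs) (true ∷ T)  ((_ , a≢) ∷ avoid) iso (inj₂ (inj₂ (r , _))) =
    contradiction (isolated-pick fs T avoid iso r) a≢

  rungs-avoid : ∀ {k z a} (is : Vec (Fin m) k) → All (a ≢_) (covered is z) →
                Allᵛ.All (λ e → a ≢ proj₁ e × a ≢ proj₂ e) (rungs is z)
  rungs-avoid         []       _                    = []
  rungs-avoid {z = z} (i ∷ is) (a≢ui ∷ a≢vi ∷ a∉) =
    (a≢ui , a≢u) ∷ (a≢ui , a≢v) ∷ (a≢vi , a≢u) ∷ (a≢vi , a≢v) ∷ rungs-avoid is a∉
    where
    a≢u = All.lookup a∉ (u-top∈ is z)
    a≢v = All.lookup a∉ (v-top∈ is z)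

  outgoing incoming : Fin m → Fin m → Vec (Node × Node) 2
  outgoing h i = (v h , u i) ∷ (v h , v i) ∷ []
  incoming h i = (u i , v h) ∷ (v i , v h) ∷ []

  module _ (h z : Fin m) (h≢z : h ≢ z) where

    run-describes : ∀ {k} (is : Vec (Fin m) k) → Unique is → Allᵛ.All (h ≢_) is → Allᵛ.All (_≢ z) is → ∀ s T →
      Describes _≟ˣ_ (v h) (u (top is z)) (v (top is z)) (covered is z)
        (pick (rungs is z) T (pick (incoming h z) s [])) (run k T (start s))
    run-describes [] _ _ _ s@(_ ∷ _ ∷ []) [] = start-describes _≟ˣ_ (λ ()) (λ { refl → h≢z refl }) (λ ()) s
    run-describes {suc k} (i ∷ is) (i∉ ∷ unique) (h≢i ∷ h∉) (i≢z ∷ z∉) s (c₀ ∷ c₁ ∷ c₂ ∷ c₃ ∷ T) =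
      advance-describes _≟ˣ_ (c₀ ∷ c₁ ∷ c₂ ∷ c₃ ∷ []) (run k T (start s)) (u-top∈ is z) (v-top∈ is z) (λ ())
        ((λ ()) ∷ ui∉) ((λ { refl → h≢i refl }) ∷ vi∉) (isolated ui∉ (λ ())) (isolated vi∉ (λ { refl → h≢i refl }))
        (run-describes is unique h∉ z∉ s T)
      where
      ui∉ = u∉covered i≢z i∉
      vi∉ = v∉covered i≢z i∉

      isolated : ∀ {a} → All (a ≢_) (covered is z) → a ≢ v h → Isolated _≟ˣ_ (pick (rungs is z) T (pick (incoming h z) s [])) a
      isolated a∉ a≢h = isolated-pick (rungs is z) T (rungs-avoid is a∉)
        (isolated-pick (incoming h z) s
          ((All.lookup a∉ (u-last∈ is z) , a≢h) ∷ (All.lookup a∉ (v-last∈ is z) , a≢h) ∷ []) (λ a≡b → a≡b))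

    accepted-reflects : ∀ {k} (is : Vec (Fin m) k) (vs : List Node) → Unique is → Allᵛ.All (h ≢_) is → Allᵛ.All (_≢ z) is →
      (∀ {x} → x ∈ˡ vs ⇔ x ∈ˡ v h ∷ covered is z) → ∀ s c T →
      let es = pick (incoming h z) s (pick (outgoing h (top is z)) c (pick (rungs is z) T [])) in
      Reflects (Forest _≟ˣ_ es × (∀ {x y} → x ∈ˡ vs → y ∈ˡ vs → Reach _≟ˣ_ es x y)) (accepted k s c T)
    accepted-reflects {k} is vs unique h∉ z∉ vs⇔ s c@(_ ∷ _ ∷ []) T = reflects-⇔ to from
      (finish-reflects _≟ˣ_ c (run k T (start s)) (u-top∈ is z) (v-top∈ is z) (run-describes is unique h∉ z∉ s T))
      where
      es fs : List (Node × Node)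
      es = pick (incoming h z) s (pick (outgoing h (top is z)) c (pick (rungs is z) T []))
      fs = pick (outgoing h (top is z)) c (pick (rungs is z) T (pick (incoming h z) s []))

      es↭fs : es ↭ fs
      es↭fs = pick-rotate (incoming h z) (outgoing h (top is z)) (rungs is z) s c T

      to : Forest _≟ˣ_ fs × All (λ x → Reach _≟ˣ_ fs x (v h)) (covered is z) →
           Forest _≟ˣ_ es × (∀ {x y} → x ∈ˡ vs → y ∈ˡ vs → Reach _≟ˣ_ es x y)
      to (F , reach) = forest-↭ _≟ˣ_ (↭-sym es↭fs) F ,
        λ x∈ y∈ → reach-trans _≟ˣ_ es (hub (Equivalence.to vs⇔ x∈)) (reach-sym _≟ˣ_ es (hub (Equivalence.to vs⇔ y∈)))
        where
        hub : ∀ {x} → x ∈ˡ v h ∷ covered is z → Reach _≟ˣ_ es x (v h)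
        hub (here refl) = reach-refl _≟ˣ_ es
        hub (there x∈)  = reach-↭ _≟ˣ_ (↭-sym es↭fs) (All.lookup reach x∈)

      from : Forest _≟ˣ_ es × (∀ {x y} → x ∈ˡ vs → y ∈ˡ vs → Reach _≟ˣ_ es x y) →
             Forest _≟ˣ_ fs × All (λ x → Reach _≟ˣ_ fs x (v h)) (covered is z)
      from (F , reach) = forest-↭ _≟ˣ_ es↭fs F ,
        All.tabulate λ x∈ → reach-↭ _≟ˣ_ es↭fs (reach (Equivalence.from vs⇔ (there x∈)) (Equivalence.from vs⇔ (here refl)))

-- Zeros over 𝔽₂

-- The value over 𝔽₂ at α of the sum of ∏_{i ∉ T} αᵢ over all T with f T, expanded by
-- deletion and contraction of the first coordinate.
Φ : ∀ {n} → Vec Bool n → (Vec Bool n → Bool) → Bool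
Φ []      f = f []
Φ (a ∷ α) f = (a ∧ Φ α (λ T → f (outside ∷ T))) xor Φ α (λ T → f (inside ∷ T))

∑ : ∀ n → (Vec Bool n → ℕ) → ℕ
∑ zero    f = f []
∑ (suc n) f = ∑ n (λ α → f (false ∷ α)) + ∑ n (λ α → f (true ∷ α))

indicator : Bool → ℕ
indicator b = if b then 1 else 0

bit : Bool → Fin 2
bit false = 0F
bit true  = 1F

open RawSemiring (𝔽 2) using () renaming (_+_ to _⊕_; _*_ to _⊗_)
private
  module 𝔹 = CommutativeSemigroupProperties (CommutativeRing.+-commutativeSemigroup xor-∧-commutativeRing)
  module ℕ+ = CommutativeSemigroupProperties +-commutativeSemigroup

bit-xor : ∀ a b → bit (a xor b) ≡ bit a ⊕ bit b
bit-xor false false = refl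
bit-xor false true  = refl
bit-xor true  false = refl
bit-xor true  true  = refl

bit-∧ : ∀ a b → bit (a ∧ b) ≡ bit a ⊗ bit b
bit-∧ false false = refl
bit-∧ false true  = refl
bit-∧ true  false = refl
bit-∧ true  true  = refl

bit-zero? : ∀ b → does (bit b ≟ᶠ 0F) ≡ not b
bit-zero? false = refl
bit-zero? true  = refl

⊕-identityˡ : ∀ a → 0F ⊕ a ≡ a
⊕-identityˡ = from-yes (all? λ a → (0F ⊕ a) ≟ᶠ a)

⊕-assoc : ∀ a b c → (a ⊕ b) ⊕ c ≡ a ⊕ (b ⊕ c)
⊕-assoc = from-yes (all? λ a → all? λ b → all? λ c → ((a ⊕ b) ⊕ c) ≟ᶠ (a ⊕ (b ⊕ c)))

⊗-zeroʳ : ∀ a → a ⊗ 0F ≡ 0F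
⊗-zeroʳ = from-yes (all? λ a → (a ⊗ 0F) ≟ᶠ 0F)

⊗-distribˡ-⊕ : ∀ a b c → a ⊗ (b ⊕ c) ≡ (a ⊗ b) ⊕ (a ⊗ c)
⊗-distribˡ-⊕ = from-yes (all? λ a → all? λ b → all? λ c → (a ⊗ (b ⊕ c)) ≟ᶠ ((a ⊗ b) ⊕ (a ⊗ c)))

filter-map : ∀ {A B : Set} {P : Pred B 0ℓ} (P? : Decidable P) (f : A → B) xs →
             filter P? (map f xs) ≡ map f (filter (P? ∘ f) xs)
filter-map P? f []       = refl
filter-map P? f (x ∷ xs) with does (P? (f x))
... | false = filter-map P? f xs
... | true  = cong (f x ∷_) (filter-map P? f xs)

filter-vecs : ∀ {A : Set} {x y : A} {n} {P : Pred (Vec A (suc n)) 0ℓ} (P? : Decidable P) →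
              filter P? (vecs (x ∷ y ∷ []) (suc n)) ≡
              map (x ∷_) (filter (P? ∘ (x ∷_)) (vecs (x ∷ y ∷ []) n)) ++ map (y ∷_) (filter (P? ∘ (y ∷_)) (vecs (x ∷ y ∷ []) n))
filter-vecs {x = x} {y} {n} P? = begin
  filter P? (map (x ∷_) vs ++ map (y ∷_) vs ++ [])             ≡⟨ cong (λ ws → filter P? (map (x ∷_) vs ++ ws)) (++-identityʳ _) ⟩
  filter P? (map (x ∷_) vs ++ map (y ∷_) vs)                   ≡⟨ filter-++ P? (map (x ∷_) vs) _ ⟩
  filter P? (map (x ∷_) vs) ++ filter P? (map (y ∷_) vs)       ≡⟨ cong₂ _++_ (filter-map P? (x ∷_) vs) (filter-map P? (y ∷_) vs) ⟩
  map (x ∷_) (filter (P? ∘ (x ∷_)) vs) ++ map (y ∷_) (filter (P? ∘ (y ∷_)) vs) ∎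
  where
  open ≡-Reasoning
  vs = vecs (x ∷ y ∷ []) n

length-filter-vecs : ∀ n {P : Pred (Vec (Fin 2) n) 0ℓ} (P? : Decidable P) →
                     length (filter P? (vecs (allFin 2) n)) ≡ ∑ n (λ α → indicator (does (P? (Vec.map bit α))))
length-filter-vecs zero    P? with does (P? [])
... | false = refl
... | true  = refl
length-filter-vecs (suc n) P? = begin
  length (filter P? (vecs (allFin 2) (suc n)))
    ≡⟨ cong length (filter-vecs P?) ⟩
  length (map (0F ∷_) F₀ ++ map (1F ∷_) F₁)
    ≡⟨ trans (length-++ (map (0F ∷_) F₀)) (cong₂ _+_ (length-map (0F ∷_) F₀) (length-map (1F ∷_) F₁)) ⟩
  length F₀ + length F₁
    ≡⟨ cong₂ _+_ (length-filter-vecs n (P? ∘ (0F ∷_))) (length-filter-vecs n (P? ∘ (1F ∷_))) ⟩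
  ∑ (suc n) (λ α → indicator (does (P? (Vec.map bit α)))) ∎
  where
  open ≡-Reasoning
  F₀ = filter (P? ∘ (0F ∷_)) (vecs (allFin 2) n)
  F₁ = filter (P? ∘ (1F ∷_)) (vecs (allFin 2) n)

sum₂ product₂ : List (Fin 2) → Fin 2
sum₂     = foldr _⊕_ 0F
product₂ = foldr _⊗_ 1F

sum₂-++ : ∀ xs ys → sum₂ (xs ++ ys) ≡ sum₂ xs ⊕ sum₂ ys
sum₂-++ []       ys = sym (⊕-identityˡ (sum₂ ys))
sum₂-++ (x ∷ xs) ys = trans (cong (x ⊕_) (sum₂-++ xs ys)) (sym (⊕-assoc x (sum₂ xs) (sum₂ ys)))

sum₂-scale : ∀ {A : Set} c (g : A → Fin 2) xs → sum₂ (map (λ x → c ⊗ g x) xs) ≡ c ⊗ sum₂ (map g xs)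
sum₂-scale c g []       = sym (⊗-zeroʳ c)
sum₂-scale c g (x ∷ xs) = trans (cong ((c ⊗ g x) ⊕_) (sum₂-scale c g xs)) (sym (⊗-distribˡ-⊕ c (g x) _))

weight : ∀ {n} → Vec (Fin 2) n → Subset n → Fin 2
weight α T = product₂ (map (lookup α) (filter (λ e → ¬? (e ∈? T)) (allFin _)))

missing-suc : ∀ {n} s (T : Subset n) →
              filter (λ e → ¬? (e ∈? (s ∷ T))) (List.tabulate suc) ≡ map suc (filter (λ e → ¬? (e ∈? T)) (allFin n))
missing-suc {n} s T = begin
  filter out? (List.tabulate suc)         ≡⟨ cong (filter out?) (sym (map-tabulate (λ i → i) suc)) ⟩
  filter out? (map suc (allFin n))        ≡⟨ filter-map out? suc (allFin n) ⟩
  map suc (filter (out? ∘ suc) (allFin n))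
    ≡⟨ cong (map suc) (filter-≐ (out? ∘ suc) (λ e → ¬? (e ∈? T)) ((λ ∉ → ∉ ∘ Vec.there) , (λ ∉ → ∉ ∘ drop-there)) (allFin n)) ⟩
  map suc (filter (λ e → ¬? (e ∈? T)) (allFin n)) ∎
  where
  open ≡-Reasoning
  out? : ∀ e → Dec (e ∉ (s ∷ T))
  out? e = ¬? (e ∈? (s ∷ T))

weight-outside : ∀ {n} a (α : Vec (Fin 2) n) T → weight (a ∷ α) (outside ∷ T) ≡ a ⊗ weight α T
weight-outside a α T = cong (λ es → a ⊗ product₂ es)
  (trans (cong (map (lookup (a ∷ α))) (missing-suc outside T)) (sym (map-∘ (filter (λ e → ¬? (e ∈? T)) (allFin _)))))

weight-inside : ∀ {n} a (α : Vec (Fin 2) n) T → weight (a ∷ α) (inside ∷ T) ≡ weight α T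
weight-inside a α T = cong product₂
  (trans (cong (map (lookup (a ∷ α))) (missing-suc inside T)) (sym (map-∘ (filter (λ e → ¬? (e ∈? T)) (allFin _)))))

sum-weights : ∀ {n} (α : Vec Bool n) {P : Pred (Subset n) 0ℓ} (P? : Decidable P) →
              sum₂ (map (weight (Vec.map bit α)) (filter P? (subsets n))) ≡ bit (Φ α (does ∘ P?))
sum-weights []      P? with does (P? [])
... | false = refl
... | true  = refl
sum-weights {suc n} (a ∷ α) P? = begin
  sum₂ (map w (filter P? (subsets (suc n))))
    ≡⟨ cong (sum₂ ∘ map w) (filter-vecs P?) ⟩
  sum₂ (map w (map (outside ∷_) Fₒ ++ map (inside ∷_) Fᵢ))
    ≡⟨ cong sum₂ (map-++ w (map (outside ∷_) Fₒ) _) ⟩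
  sum₂ (map w (map (outside ∷_) Fₒ) ++ map w (map (inside ∷_) Fᵢ))
    ≡⟨ sum₂-++ (map w (map (outside ∷_) Fₒ)) _ ⟩
  sum₂ (map w (map (outside ∷_) Fₒ)) ⊕ sum₂ (map w (map (inside ∷_) Fᵢ))
    ≡⟨ cong₂ _⊕_ (cong sum₂ (trans (sym (map-∘ Fₒ)) (map-cong (weight-outside (bit a) α') Fₒ)))
                 (cong sum₂ (trans (sym (map-∘ Fᵢ)) (map-cong (weight-inside (bit a) α') Fᵢ))) ⟩
  sum₂ (map (λ T → bit a ⊗ weight α' T) Fₒ) ⊕ sum₂ (map (weight α') Fᵢ)
    ≡⟨ cong₂ _⊕_ (sum₂-scale (bit a) (weight α') Fₒ) refl ⟩
  (bit a ⊗ sum₂ (map (weight α') Fₒ)) ⊕ sum₂ (map (weight α') Fᵢ)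
    ≡⟨ cong₂ (λ x y → (bit a ⊗ x) ⊕ y) (sum-weights α (P? ∘ (outside ∷_))) (sum-weights α (P? ∘ (inside ∷_))) ⟩
  (bit a ⊗ bit Φₒ) ⊕ bit Φᵢ
    ≡⟨ cong (_⊕ bit Φᵢ) (bit-∧ a Φₒ) ⟨
  bit (a ∧ Φₒ) ⊕ bit Φᵢ
    ≡⟨ bit-xor (a ∧ Φₒ) Φᵢ ⟨
  bit (Φ (a ∷ α) (does ∘ P?)) ∎
  where
  open ≡-Reasoning
  α' = Vec.map bit α
  w  = weight (bit a ∷ α')
  Fₒ = filter (P? ∘ (outside ∷_)) (subsets n)
  Fᵢ = filter (P? ∘ (inside ∷_)) (subsets n)
  Φₒ = Φ α (does ∘ P? ∘ (outside ∷_))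
  Φᵢ = Φ α (does ∘ P? ∘ (inside ∷_))

Φ-cong : ∀ {n} (α : Vec Bool n) {f g} → (∀ T → f T ≡ g T) → Φ α f ≡ Φ α g
Φ-cong []      f≗g = f≗g []
Φ-cong (a ∷ α) f≗g =
  cong₂ (λ x y → (a ∧ x) xor y) (Φ-cong α (λ T → f≗g (outside ∷ T))) (Φ-cong α (λ T → f≗g (inside ∷ T)))

∧-xor-interchange : ∀ a p q r s → (a ∧ (p xor q)) xor (r xor s) ≡ ((a ∧ p) xor r) xor ((a ∧ q) xor s)
∧-xor-interchange a p q r s =
  trans (cong (_xor (r xor s)) (∧-distribˡ-xor a p q)) (𝔹.interchange (a ∧ p) (a ∧ q) r s)

Φ-false : ∀ {n} (α : Vec Bool n) → Φ α (λ _ → false) ≡ false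
Φ-false []      = refl
Φ-false (a ∷ α) = trans (cong₂ (λ x y → (a ∧ x) xor y) (Φ-false α) (Φ-false α)) (cong (_xor false) (∧-zeroʳ a))

Φ-xor : ∀ {n} (α : Vec Bool n) f g → Φ α (λ T → f T xor g T) ≡ Φ α f xor Φ α g
Φ-xor []      f g = refl
Φ-xor (a ∷ α) f g = trans
  (cong₂ (λ x y → (a ∧ x) xor y) (Φ-xor α (λ T → f (outside ∷ T)) (λ T → g (outside ∷ T)))
                                 (Φ-xor α (λ T → f (inside ∷ T)) (λ T → g (inside ∷ T))))
  (∧-xor-interchange a _ _ _ _)

Φ-∧ : ∀ {n} b (α : Vec Bool n) f → Φ α (λ T → b ∧ f T) ≡ b ∧ Φ α f
Φ-∧ false α f = Φ-false α
Φ-∧ true  α f = refl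

-- `Φ α` is linear over 𝔽₂ in the function it sums, so summations over disjoint sets of edges
-- commute.
Φ-swap : ∀ {k n} (α : Vec Bool k) (β : Vec Bool n) (f : Vec Bool k → Vec Bool n → Bool) →
         Φ α (λ S → Φ β (f S)) ≡ Φ β (λ T → Φ α (λ S → f S T))
Φ-swap []      β f = refl
Φ-swap (a ∷ α) β f = begin
  (a ∧ Φ α (λ S → Φ β (f (outside ∷ S)))) xor Φ α (λ S → Φ β (f (inside ∷ S)))
    ≡⟨ cong₂ (λ x y → (a ∧ x) xor y) (Φ-swap α β (f ∘ (outside ∷_))) (Φ-swap α β (f ∘ (inside ∷_))) ⟩
  (a ∧ Φ β (λ T → Φ α (λ S → f (outside ∷ S) T))) xor Φ β (λ T → Φ α (λ S → f (inside ∷ S) T))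
    ≡⟨ cong (_xor _) (sym (Φ-∧ a β _)) ⟩
  Φ β (λ T → a ∧ Φ α (λ S → f (outside ∷ S) T)) xor Φ β (λ T → Φ α (λ S → f (inside ∷ S) T))
    ≡⟨ sym (Φ-xor β _ _) ⟩
  Φ β (λ T → Φ (a ∷ α) (λ S → f S T)) ∎
  where open ≡-Reasoning

∑-cong : ∀ n {f g : Vec Bool n → ℕ} → (∀ α → f α ≡ g α) → ∑ n f ≡ ∑ n g
∑-cong zero    f≗g = f≗g []
∑-cong (suc n) f≗g = cong₂ _+_ (∑-cong n (λ α → f≗g (false ∷ α))) (∑-cong n (λ α → f≗g (true ∷ α)))

∑-+ : ∀ n f g → ∑ n (λ α → f α + g α) ≡ ∑ n f + ∑ n g
∑-+ zero    f g = refl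
∑-+ (suc n) f g = trans (cong₂ _+_ (∑-+ n _ _) (∑-+ n _ _)) (ℕ+.interchange (∑ n _) (∑ n _) (∑ n _) (∑ n _))

∑-swap : ∀ k n (f : Vec Bool k → Vec Bool n → ℕ) → ∑ k (λ α → ∑ n (f α)) ≡ ∑ n (λ β → ∑ k (λ α → f α β))
∑-swap zero    n f = refl
∑-swap (suc k) n f = trans (cong₂ _+_ (∑-swap k n (f ∘ (false ∷_))) (∑-swap k n (f ∘ (true ∷_)))) (sym (∑-+ n _ _))

∑-cong-% : ∀ n d .{{_ : NonZero d}} (f g : Vec Bool n → ℕ) → (∀ α → f α % d ≡ g α % d) → ∑ n f % d ≡ ∑ n g % d
∑-cong-% zero    d f g f≈g = f≈g []
∑-cong-% (suc n) d f g f≈g = begin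
  (∑ n f₀ + ∑ n f₁) % d              ≡⟨ %-distribˡ-+ (∑ n f₀) (∑ n f₁) d ⟩
  (∑ n f₀ % d + ∑ n f₁ % d) % d      ≡⟨ cong₂ (λ x y → (x + y) % d) (∑-cong-% n d f₀ g₀ (λ α → f≈g (false ∷ α)))
                                                                       (∑-cong-% n d f₁ g₁ (λ α → f≈g (true ∷ α))) ⟩
  (∑ n g₀ % d + ∑ n g₁ % d) % d      ≡⟨ %-distribˡ-+ (∑ n g₀) (∑ n g₁) d ⟨
  (∑ n g₀ + ∑ n g₁) % d              ∎
  where
  open ≡-Reasoning
  f₀ = f ∘ (false ∷_)
  f₁ = f ∘ (true ∷_)
  g₀ = g ∘ (false ∷_)
  g₁ = g ∘ (true ∷_)

-- Subsets of the edge set are typed by the length of the edge list. Pairing this length with the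
-- vector lets a single equation replace both.
asVec : ∀ {A : Set} → List A → Σ ℕ (Vec A)
asVec xs = length xs , fromList xs

asVec-toList : ∀ {A : Set} {n} {xs : List A} (ys : Vec A n) → xs ≡ toList ys → asVec xs ≡ (n , ys)
asVec-toList []       refl = refl
asVec-toList (y ∷ ys) refl = cong (λ (n , zs) → suc n , y ∷ zs) (asVec-toList ys refl)

module _ (G : Graph) where
  open Graph G using (_≟_)

  zeros≡∑ : ∀ {n} (es : Vec (V G × V G) n) → asVec (edges G) ≡ (n , es) →
    (f : Vec Bool n → Bool) →
    (∀ T → Reflects (Forest _≟_ (pick es T []) ×
                     (∀ {x y} → x ∈ˡ vertices G → y ∈ˡ vertices G → Reach _≟_ (pick es T []) x y)) (f T)) →
    zeros G 2 ≡ ∑ n (λ α → indicator (not (Φ α f)))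
  zeros≡∑ _ refl f reflects = trans
    (length-filter-vecs n (λ α → Ψ G (𝔽 2) α ≟ᶠ 0F))
    (∑-cong n (λ α → cong indicator (begin
      does (Ψ G (𝔽 2) (Vec.map bit α) ≟ᶠ 0F)
        ≡⟨ cong (λ x → does (x ≟ᶠ 0F)) (sum-weights α (isSpanningTree? G)) ⟩
      does (bit (Φ α (does ∘ isSpanningTree? G)) ≟ᶠ 0F)
        ≡⟨ bit-zero? _ ⟩
      not (Φ α (does ∘ isSpanningTree? G))
        ≡⟨ cong not (Φ-cong α tree) ⟩
      not (Φ α f) ∎)))
    where
    open ≡-Reasoning
    n = length (edges G)

    tree : ∀ T → does (isSpanningTree? G T) ≡ f T
    tree T = det (reflects-⇔ to from (proof (isSpanningTree? G T))) (reflects T)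
      where open Equivalence (isSpanningTree⇔spanning G T)

-- Counting modulo 8

value : Vec Bool 5 → Partition → Bool
value (h ∷ _)                 txy   = h
value (_ ∷ h ∷ _)             t∣xy  = h
value (_ ∷ _ ∷ h ∷ _)         x∣ty  = h
value (_ ∷ _ ∷ _ ∷ h ∷ _)     y∣tx  = h
value (_ ∷ _ ∷ _ ∷ _ ∷ h ∷ _) t∣x∣y = h

table : (Partition → Bool) → Vec Bool 5
table f = f txy ∷ f t∣xy ∷ f x∣ty ∷ f y∣tx ∷ f t∣x∣y ∷ []

-- The transpose of the transfer map of one layer with edge values `α`: the new form at `π` is the
-- `α`-weighted sum of `h` over the partitions that the layer can make of `π`, discarded choices
-- counting as 0.
pull : Vec Bool 4 → Vec Bool 5 → Vec Bool 5
pull α h = table (λ π → Φ α (λ c → maybe′ (value h) false (advance c π)))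

-- Zₖ of the header; opaque because comparing unfolded instances would enumerate all 16ᵏ branches.
opaque
  zerosFrom : ℕ → Vec Bool 5 → ℕ
  zerosFrom zero    h = ∑ 2 (λ α → indicator (not (Φ α (λ c → value h (start c)))))
  zerosFrom (suc k) h = ∑ 4 (λ α → zerosFrom k (pull α h))

-- The sum over the three partitions with exactly two blocks.
middle : Vec Bool 5 → Bool
middle (_ ∷ h₁ ∷ h₂ ∷ h₃ ∷ _) = h₁ xor h₂ xor h₃

residue₁ : Vec Bool 5 → ℕ
residue₁ h@(h₀ ∷ _ ∷ _ ∷ _ ∷ h₄ ∷ []) = 2 * indicator (middle h) + 4 * indicator (h₄ ∧ (h₀ xor middle h))

residue₂ : Vec Bool 5 → ℕ
residue₂ h = 4 * indicator (middle h)

every : ∀ n → (Vec Bool n → Bool) → Bool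
every zero    f = f []
every (suc n) f = every n (λ α → f (false ∷ α)) ∧ every n (λ α → f (true ∷ α))

every-lookup : ∀ n {f} → every n f ≡ true → ∀ α → f α ≡ true
every-lookup zero    p []          = p
every-lookup (suc n) p (false ∷ α) = every-lookup n (∧-conicalˡ _ _ p) α
every-lookup (suc n) p (true ∷ α)  = every-lookup n (∧-conicalʳ _ _ p) α

-- The search stays Boolean, so for n = 5 a `refl` settles the congruence for all 32 forms at once.
agree-% : ∀ n d .{{_ : NonZero d}} (f g : Vec Bool n → ℕ) →
          every n (λ α → f α % d ≡ᵇ g α % d) ≡ true → ∀ α → f α % d ≡ g α % d
agree-% n d f g p α = ≡ᵇ⇒≡ _ _ (subst T (sym (every-lookup n p α)) _)

opaque
  unfolding zerosFrom

  zerosFrom-1 : ∀ h → zerosFrom 1 h % 8 ≡ residue₁ h % 8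
  zerosFrom-1 = agree-% 5 8 (zerosFrom 1) residue₁ refl

  zerosFrom-2 : ∀ h → zerosFrom 2 h % 8 ≡ residue₂ h % 8
  zerosFrom-2 h = trans
    (∑-cong-% 4 8 (λ α → zerosFrom 1 (pull α h)) (λ α → residue₁ (pull α h)) (λ α → zerosFrom-1 (pull α h)))
    -- With the counts for one layer replaced by `residue₁`, the evaluation covers 32 forms times 16
    -- edge values and never unfolds two layers.
    (agree-% 5 8 (λ h → ∑ 4 (λ α → residue₁ (pull α h))) residue₂ refl h)

  zerosFrom-3+ : ∀ k h → zerosFrom (3 + k) h % 8 ≡ 0
  zerosFrom-3+ zero    h = trans
    (∑-cong-% 4 8 (λ α → zerosFrom 2 (pull α h)) (λ α → residue₂ (pull α h)) (λ α → zerosFrom-2 (pull α h)))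
    (agree-% 5 8 (λ h → ∑ 4 (λ α → residue₂ (pull α h))) (λ _ → 0) refl h)
  zerosFrom-3+ (suc k) h = ∑-cong-% 4 8 (λ α → zerosFrom (3 + k) (pull α h)) (λ _ → 0) (λ α → zerosFrom-3+ k (pull α h))

-- Duality between sweeping states and pulling back forms

pulls : ∀ k → Vec Bool (k * 4) → Vec Bool 5 → Vec Bool 5
pulls zero    []                        h = h
pulls (suc k) (a₀ ∷ a₁ ∷ a₂ ∷ a₃ ∷ α) h = pulls k α (pull (a₀ ∷ a₁ ∷ a₂ ∷ a₃ ∷ []) h)

value-table : ∀ f π → value (table f) π ≡ f π
value-table f txy   = refl
value-table f t∣xy  = refl
value-table f x∣ty  = refl
value-table f y∣tx  = refl
value-table f t∣x∣y = refl

-- The layer at the head of the vector is passed last, hence is the first to act on the form;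
-- `Φ-swap` moves its summation inside that over the other layers.
pulls-run : ∀ k (α : Vec Bool (k * 4)) h π →
            Φ α (λ T → maybe′ (value h) false (run k T π)) ≡ value (pulls k α h) π
pulls-run zero    []                        h π = refl
pulls-run (suc k) (a₀ ∷ a₁ ∷ a₂ ∷ a₃ ∷ α) h π = begin
  Φ α₄ (λ c → Φ α (λ T → maybe′ (value h) false (run k T π >>= advance c)))
    ≡⟨ Φ-swap α₄ α (λ c T → maybe′ (value h) false (run k T π >>= advance c)) ⟩
  Φ α (λ T → Φ α₄ (λ c → maybe′ (value h) false (run k T π >>= advance c)))
    ≡⟨ Φ-cong α (λ T → absorb (run k T π)) ⟩
  Φ α (λ T → maybe′ (value (pull α₄ h)) false (run k T π))
    ≡⟨ pulls-run k α (pull α₄ h) π ⟩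
  value (pulls k α (pull α₄ h)) π ∎
  where
  open ≡-Reasoning
  α₄ = a₀ ∷ a₁ ∷ a₂ ∷ a₃ ∷ []

  absorb : ∀ s → Φ α₄ (λ c → maybe′ (value h) false (s >>= advance c)) ≡ maybe′ (value (pull α₄ h)) false s
  absorb nothing  = Φ-false α₄
  absorb (just π) = sym (value-table (λ π → Φ α₄ (λ c → maybe′ (value h) false (advance c π))) π)

opaque
  unfolding zerosFrom

  ∑-pulls : ∀ k h → ∑ (k * 4) (λ α → ∑ 2 (λ β → indicator (not (Φ β (λ s → value (pulls k α h) (start s)))))) ≡ zerosFrom k h
  ∑-pulls zero    h = refl
  ∑-pulls (suc k) h = ∑-cong 4
    -- The sum over `suc k * 4` coordinates unfolds to one over the first four around one over the
    -- rest. The four entries are matched explicitly because `pulls` computes only on such vectors.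
    {f = λ { (a₀ ∷ a₁ ∷ a₂ ∷ a₃ ∷ []) → ∑ (k * 4) (λ α → zerosFrom 0 (pulls (suc k) (a₀ ∷ a₁ ∷ a₂ ∷ a₃ ∷ α) h)) }}
    {g = λ α → zerosFrom k (pull α h)} λ { α@(_ ∷ _ ∷ _ ∷ _ ∷ []) → ∑-pulls k (pull α h) }

-- For β = (p, q) this is the form (pq, p + q, q, p, 1). Its `middle` is p + q + q + p = 0, which
-- settles the shortest ladder, where the count does not yet vanish modulo 8 for every form.
finish-table : Vec Bool 2 → Vec Bool 5
finish-table β = table (λ π → Φ β (λ c → finish c π))

Φ-accepted : ∀ k (β γ : Vec Bool 2) (α : Vec Bool (k * 4)) →
  Φ β (λ s → Φ γ (λ c → Φ α (accepted k s c))) ≡ Φ β (λ s → value (pulls k α (finish-table γ)) (start s))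
Φ-accepted k β γ α = Φ-cong β λ s → begin
  Φ γ (λ c → Φ α (accepted k s c))
    ≡⟨ Φ-swap γ α (accepted k s) ⟩
  Φ α (λ T → Φ γ (λ c → accepted k s c T))
    ≡⟨ Φ-cong α (λ T → absorb (run k T (start s))) ⟩
  Φ α (λ T → maybe′ (value (finish-table γ)) false (run k T (start s)))
    ≡⟨ pulls-run k α (finish-table γ) (start s) ⟩
  value (pulls k α (finish-table γ)) (start s) ∎
  where
  open ≡-Reasoning

  absorb : ∀ s → Φ γ (λ c → maybe′ (finish c) false s) ≡ maybe′ (value (finish-table γ)) false s
  absorb nothing  = Φ-false γ
  absorb (just π) = sym (value-table (λ π → Φ γ (λ c → finish c π)) π)

∑-zerosFrom : ∀ k → ∑ 2 (λ γ → zerosFrom (2 + k) (finish-table γ)) % 8 ≡ 0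
∑-zerosFrom zero    = ∑-cong-% 2 8 (zerosFrom 2 ∘ finish-table) (residue₂ ∘ finish-table) (zerosFrom-2 ∘ finish-table)
∑-zerosFrom (suc k) = ∑-cong-% 2 8 (zerosFrom (3 + k) ∘ finish-table) (λ _ → 0) (zerosFrom-3+ k ∘ finish-table)

-- The edge list puts the edges at the start of the sweep first, then those at its end, then the
-- layers, whereas `zerosFrom` sums over the end outermost and over the start innermost.
∑-rotate : ∀ j l n (f : Vec Bool j → Vec Bool l → Vec Bool n → ℕ) (g : Vec Bool l → ℕ) →
           (∀ γ → ∑ n (λ α → ∑ j (λ β → f β γ α)) ≡ g γ) → ∑ j (λ β → ∑ l (λ γ → ∑ n (f β γ))) ≡ ∑ l g
∑-rotate j l n f g f≡g = trans (∑-swap j l (λ β γ → ∑ n (f β γ)))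
  (∑-cong l (λ γ → trans (∑-swap j n (λ β α → f β γ α)) (f≡g γ)))

split : ∀ {n} → (Vec Bool 2 → Vec Bool 2 → Vec Bool n → Bool) → Vec Bool (2 + (2 + n)) → Bool
split f (s₀ ∷ s₁ ∷ c₀ ∷ c₁ ∷ T) = f (s₀ ∷ s₁ ∷ []) (c₀ ∷ c₁ ∷ []) T

isZero : ∀ {n} → (Vec Bool 2 → Vec Bool 2 → Vec Bool n → Bool) → Vec Bool 2 → Vec Bool 2 → Vec Bool n → ℕ
isZero f β γ α = indicator (not (Φ β (λ s → Φ γ (λ c → Φ α (f s c)))))

∑-split : ∀ n (f : Vec Bool 2 → Vec Bool 2 → Vec Bool n → Bool) →
          ∑ (2 + (2 + n)) (λ α → indicator (not (Φ α (split f)))) ≡ ∑ 2 (λ β → ∑ 2 (λ γ → ∑ n (isZero f β γ)))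
∑-split n f = refl

zeros-by-state : ∀ k γ → ∑ (k * 4) (λ α → ∑ 2 (λ β → isZero (accepted k) β γ α)) ≡ zerosFrom k (finish-table γ)
zeros-by-state k γ = trans
  (∑-cong (k * 4) λ α → ∑-cong 2 {f = λ β → isZero (accepted k) β γ α}
    {g = λ β → indicator (not (Φ β (λ s → value (pulls k α (finish-table γ)) (start s))))}
    (λ β → cong (indicator ∘ not) (Φ-accepted k β γ α)))
  (∑-pulls k (finish-table γ))

opaque
  -- Opaque since for `k = 2 + n` twelve coordinates are explicit, and comparing unfolded sums would
  -- expand 2¹² branches.
  countZeros : ℕ → ℕ
  countZeros k = ∑ (2 + (2 + k * 4)) (λ α → indicator (not (Φ α (split (accepted k)))))

  countZeros-by-state : ∀ k → countZeros k ≡ ∑ 2 (λ γ → zerosFrom k (finish-table γ))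
  countZeros-by-state k = trans (∑-split (k * 4) (accepted k))
    (∑-rotate 2 2 (k * 4) (isZero (accepted k)) (λ γ → zerosFrom k (finish-table γ)) (zeros-by-state k))

opaque
  unfolding countZeros

  zeros≡countZeros : ∀ G k (es : Vec (V G × V G) (2 + (2 + k * 4))) →
    asVec (edges G) ≡ (2 + (2 + k * 4) , es) →
    (∀ T → Reflects (Forest (Graph._≟_ G) (pick es T []) ×
                     (∀ {x y} → x ∈ˡ vertices G → y ∈ˡ vertices G → Reach (Graph._≟_ G) (pick es T []) x y))
                    (split (accepted k) T)) →
    zeros G 2 ≡ countZeros k
  zeros≡countZeros G k es eq = zeros≡∑ G es eq (split (accepted k))

8∣countZeros : ∀ k → countZeros (2 + k) % 8 ≡ 0
8∣countZeros k = trans (cong (_% 8) (countZeros-by-state (2 + k))) (∑-zerosFrom k)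

-- The decompleted ladder

module _ {m : ℕ} .{{_ : NonZero m}} where

  block : Fin m → List (XVertex m × XVertex m)
  block i = (u i , u (next i)) ∷ (u i , v (next i)) ∷ (v i , u (next i)) ∷ (v i , v (next i)) ∷ []

  -- The enumeration `f` is general because the induction passes to `f ∘ suc`, which starts at a
  -- later layer.
  concatMap-block : ∀ {k} (f : Fin (suc k) → Fin m) {z} → (∀ j → next (f (inject₁ j)) ≡ f (suc j)) →
                    next (f (fromℕ k)) ≡ z → concatMap block (List.tabulate f) ≡ toList (rungs (Vec.tabulate f) z)
  concatMap-block {zero}  f _          refl = refl
  concatMap-block {suc k} f consecutive end =
    cong₂ (λ i es → (u (f 0F) , u i) ∷ (u (f 0F) , v i) ∷ (v (f 0F) , u i) ∷ (v (f 0F) , v i) ∷ es)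
      (consecutive 0F) (concatMap-block (f ∘ suc) (consecutive ∘ suc) end)

module _ (n : ℕ) .(nonZero : NonZero (4 + n)) where
  private
    m k : ℕ
    m = 4 + n
    k = 2 + n

    G : Graph
    G = decompletedXLadder m {{nonZero}}

    level : Fin k → Fin m
    level j = suc (suc j)

    levels : Vec (Fin m) k
    levels = Vec.tabulate level

    keep? : (e : XVertex m × XVertex m) → Dec (proj₁ e ≢ u 1F × proj₂ e ≢ u 1F)
    keep? (x , y) = ¬? (x ≟ˣ u 1F) ×-dec ¬? (y ≟ˣ u 1F)

    pieces : Vec (XVertex m × XVertex m) (2 + (2 + k * 4))
    pieces = incoming 1F 0F Vec.++ outgoing 1F 2F Vec.++ rungs levels 0F

    u₁-deleted : All (u 1F ≢_) (covered levels 0F)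
    u₁-deleted = u∉covered {is = levels} (λ ()) (Allᵛ.tabulate⁺ {f = level} (λ _ ()))

  next-interior : (j : Fin (suc n)) → next {m} (suc (suc (inject₁ j))) ≡ suc (suc (suc j))
  next-interior j = next-inject₁ (suc (suc j))

  edges≡pieces : edges G ≡ toList pieces
  -- Layers 0 and 1 contribute eight edges, which the filter reduces by evaluation to the four at
  -- `v 1F`. All later edges avoid `u 1F` and survive.
  edges≡pieces = cong (λ es → (u 0F , v 1F) ∷ (v 0F , v 1F) ∷ (v 1F , u 2F) ∷ (v 1F , v 2F) ∷ es)
    (trans (cong (filter keep?) (concatMap-block level next-interior (next-fromℕ (3 + n))))
      (filter-all keep? (All.map (λ (p , q) → p ∘ sym , q ∘ sym) (Allᵛ.toList⁺ (rungs-avoid levels u₁-deleted)))))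

  vertices⇔ : ∀ {x} → x ∈ˡ vertices G ⇔ x ∈ˡ v 1F ∷ covered levels 0F
  vertices⇔ = mk⇔
    (λ x∈ → to _ (proj₂ (∈-filter⁻ ≢u₁? {xs = map u (allFin m) ++ map v (allFin m)} x∈)))
    (λ x∈ → ∈-filter⁺ ≢u₁? (listed _) (from x∈))
    where
    ≢u₁? : (x : XVertex m) → Dec (x ≢ u 1F)
    ≢u₁? x = ¬? (x ≟ˣ u 1F)

    to : ∀ x → x ≢ u 1F → x ∈ˡ v 1F ∷ covered levels 0F
    to (u 0F)            _    = there (u-last∈ levels 0F)
    to (u 1F)            x≢   = contradiction refl x≢
    to (u (suc (suc j))) _    = there (u-tabulate∈ level 0F j)
    to (v 0F)            _    = there (v-last∈ levels 0F)
    to (v 1F)            _    = here refl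
    to (v (suc (suc j))) _    = there (v-tabulate∈ level 0F j)

    from : ∀ {x} → x ∈ˡ v 1F ∷ covered levels 0F → x ≢ u 1F
    from (here refl) = λ ()
    from (there x∈)  = All.lookup u₁-deleted x∈ ∘ sym

    listed : ∀ x → x ∈ˡ map u (allFin m) ++ map v (allFin m)
    listed (u i) = ∈-++⁺ˡ (∈-map⁺ u (∈-allFin i))
    listed (v i) = ∈-++⁺ʳ (map u (allFin m)) (∈-map⁺ v (∈-allFin i))

  zeros-decompleted : zeros G 2 ≡ countZeros k
  zeros-decompleted = zeros≡countZeros G k pieces (asVec-toList pieces edges≡pieces) reflects
    where
    reflects : ∀ T → Reflects (Forest _≟ˣ_ (pick pieces T []) ×
      (∀ {x y} → x ∈ˡ vertices G → y ∈ˡ vertices G → Reach _≟ˣ_ (pick pieces T []) x y)) (split (accepted k) T)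
    reflects (s₀ ∷ s₁ ∷ c₀ ∷ c₁ ∷ T) =
      accepted-reflects 1F 0F (λ ()) levels (vertices G) (tabulate⁺ (λ eq → suc-injective (suc-injective eq)))
        (Allᵛ.tabulate⁺ {f = level} (λ _ ())) (Allᵛ.tabulate⁺ {f = level} (λ _ ())) vertices⇔ (s₀ ∷ s₁ ∷ []) (c₀ ∷ c₁ ∷ []) T

-- For N zeros, (N / 4) % 2 = (N % 8) / 4: the invariant is the binary digit of N of weight 4, so
-- the residue modulo 8 decides it.
c₂≡0 : ∀ G {z} → zeros G 2 ≡ z → z % 8 ≡ 0 → c₂ 2 G ≡ 0
c₂≡0 G refl eq = trans (sym (m%[n*o]/o≡m/o%n (zeros G 2) 2 4)) (cong (_/ 4) eq)

proposition4p2 : (m : ℕ) .{{_ : NonZero m}} → 4 ≤ m → c₂ 2 (decompletedXLadder m) ≡ 0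
proposition4p2 _ {{nonZero}} (s≤s (s≤s (s≤s (s≤s (z≤n {n}))))) =
  c₂≡0 (decompletedXLadder (4 + n) {{nonZero}}) (zeros-decompleted n nonZero) (8∣countZeros n)
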